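{- Let $\lambda$ be a real number. (a) If there is a $\lambda$-approximate instantiation $A\in\mathrm{GA}_\#$, then $\mathrm{GA}$ is $\lambda$-approximate. (b) If $\mathrm{GA}$ is $\lambda$-approximate, then every instantiation of $\mathrm{GA}_\#$ that at each step merges a pair whose overlap is longest (with respect to ordinary length) among the pairs whose overlap is longest$_\#$ (i.e. contains the maximum number of occurrences of $\#$) is $\lambda$-approximate.
   Context: Strings are finite words over arbitrary finite alphabets (datasets are not confined to one fixed finite alphabet; a symbol not occurring in a given dataset is always available). $|s|$ is the length of a string $s$, and $|s|_\#$ is the number of occurrences of the symbol $\#$ in $s$ (the "length$_\#$" of $s$). For strings $s,t$, $\mathrm{overlap}(s,t)$ is the longest (in ordinary length) string $y$ such that $s=xy$ and $t=yz$ for some strings $x,z$; the string $xyz$ is then the merge of $s$ and $t$ (in this order). A dataset is a finite non-empty set $\mathcal{S}=\{s_1,\dots,s_n\}$ of strings such that no string of $\mathcal{S}$ is a substring of another. A superstring of $\mathcal{S}$ is a string containing every $s_i$ as a substring. SCS: given $\mathcal{S}$, find a superstring of minimum length; $\mathrm{OPT}(\mathcal{S})$ denotes an optimal one. SCS$_\#$: given $\mathcal{S}$ and a symbol $\#$ (the important symbol), find a superstring with the smallest number of occurrences of $\#$; $\mathrm{OPT}_\#(\mathcal{S})$ denotes an optimal one. The Greedy Algorithm $\mathrm{GA}$ for SCS: starting from $\mathcal{S}$, while more than one string remains, choose an ordered pair $(s,t)$ of distinct remaining strings with $|\mathrm{overlap}(s,t)|$ maximum among all such ordered pairs, and replace the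 two strings by their merge; output the last remaining string. The algorithm $\mathrm{GA}_\#$ for SCS$_\#$ is the same except that it chooses an ordered pair with $|\mathrm{overlap}(s,t)|_\#$ maximum. Neither algorithm specifies how to break ties. An instantiation $A\in\mathrm{GA}$ (respectively $A\in\mathrm{GA}_\#$) is the algorithm with an arbitrary tie-breaking rule, i.e. a procedure that on every input performs one particular run of the algorithm; its output is $A(\mathcal{S})$. An instantiation $A\in\mathrm{GA}$ is $\lambda$-approximate if $|A(\mathcal{S})|\le\lambda|\mathrm{OPT}(\mathcal{S})|$ for every dataset $\mathcal{S}$; "$\mathrm{GA}$ is $\lambda$-approximate" means that every instantiation of $\mathrm{GA}$ is $\lambda$-approximate. An instantiation $A\in\mathrm{GA}_\#$ is $\lambda$-approximate if $|A(\mathcal{S})|_\#\le\lambda|\mathrm{OPT}_\#(\mathcal{S})|_\#$ for every dataset $\mathcal{S}$ and important symbol $\#$. -}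

module Defs where

open import Data.Empty using (⊥-elim)
open import Data.Integer.Base using (+_)
open import Data.List.Base using (List; []; _∷_; _++_; length; filter)
open import Data.List.Membership.Propositional using (_∈_)
open import Data.List.Properties using (++-conicalʳ; length-++; ∷-injectiveʳ)
open import Data.List.Relation.Binary.Infix.Heterogeneous using (Infix)
open import Data.List.Relation.Binary.Permutation.Propositional using (_↭_)
open import Data.List.Relation.Binary.Pointwise using (Pointwise-≡⇒≡; ≡⇒Pointwise-≡)
open import Data.List.Relation.Binary.Prefix.Heterogeneous as Prefix using (Prefix)
open import Data.List.Relation.Binary.Prefix.Heterogeneous.Properties using (prefix?)
open import Data.List.Relation.Unary.All using (All)
open import Data.List.Relation.Unary.Unique.Propositional using (Unique)
open import Data.Nat.Base as ℕ using (ℕ)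
import Data.Nat.Properties as ℕ
open import Data.Product.Base using (∃-syntax; _×_; _,_; proj₁; proj₂)
open import Data.Rational.Base as ℚ using (ℚ; 0ℚ; 1ℚ)
import Data.Rational.Properties as ℚ
open import Relation.Binary.PropositionalEquality
open import Relation.Nullary using (¬_; yes; no)

-- Cauchy sequences of rationals.  Two of them denote the same real when
-- each is ≤ᴿ the other.
record ℝ : Set where
  constructor mkℝ
  field
    seq    : ℕ → ℚ
    cauchy : ∀ ε → 0ℚ ℚ.< ε →
             ∃[ N ] (∀ m n → N ℕ.≤ m → N ℕ.≤ n → ℚ.∣ seq m ℚ.- seq n ∣ ℚ.≤ ε)

open ℝ public

infix 4 _≤ᴿ_
infixl 7 _*ᴿ_

_≤ᴿ_ : ℝ → ℝ → Set
x ≤ᴿ y = ∀ ε → 0ℚ ℚ.< ε → ∃[ N ] (∀ n → N ℕ.≤ n → seq x n ℚ.≤ seq y n ℚ.+ ε)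

fromℕ : ℕ → ℝ
fromℕ k = record
  { seq    = λ _ → + k ℚ./ 1
  ; cauchy = λ ε 0<ε → 0 , λ _ _ _ _ →
      subst (ℚ._≤ ε) (sym (cong ℚ.∣_∣ (ℚ.+-inverseʳ (+ k ℚ./ 1)))) (ℚ.<⇒≤ 0<ε)
  }

private
  0<1 : 0ℚ ℚ.< 1ℚ
  0<1 = ℚ.positive⁻¹ 1ℚ

  split : ∀ a b → a ≡ (a ℚ.- b) ℚ.+ b
  split a b = begin
    a                      ≡⟨ ℚ.+-identityʳ a ⟨
    a ℚ.+ 0ℚ               ≡⟨ cong (a ℚ.+_) (ℚ.+-inverseˡ b) ⟨
    a ℚ.+ (ℚ.- b ℚ.+ b)    ≡⟨ ℚ.+-assoc a (ℚ.- b) b ⟨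
    (a ℚ.- b) ℚ.+ b        ∎
    where open ≡-Reasoning

  eventuallyBounded : (x : ℝ) → ∃[ B ] (0ℚ ℚ.< B ×
    ∃[ N ] (∀ n → N ℕ.≤ n → ℚ.∣ seq x n ∣ ℚ.≤ B))
  eventuallyBounded x with cauchy x 1ℚ 0<1
  ... | N , close = 1ℚ ℚ.+ ℚ.∣ seq x N ∣ , pos , N , bound
    where
    pos : 0ℚ ℚ.< 1ℚ ℚ.+ ℚ.∣ seq x N ∣
    pos = ℚ.+-mono-<-≤ 0<1 (ℚ.0≤∣p∣ (seq x N))

    bound : ∀ n → N ℕ.≤ n → ℚ.∣ seq x n ∣ ℚ.≤ 1ℚ ℚ.+ ℚ.∣ seq x N ∣
    bound n N≤n = begin
      ℚ.∣ seq x n ∣                                ≡⟨ cong ℚ.∣_∣ (split (seq x n) (seq x N)) ⟩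
      ℚ.∣ (seq x n ℚ.- seq x N) ℚ.+ seq x N ∣      ≤⟨ ℚ.∣p+q∣≤∣p∣+∣q∣ (seq x n ℚ.- seq x N) (seq x N) ⟩
      ℚ.∣ seq x n ℚ.- seq x N ∣ ℚ.+ ℚ.∣ seq x N ∣  ≤⟨ ℚ.+-monoˡ-≤ ℚ.∣ seq x N ∣ (close n N N≤n ℕ.≤-refl) ⟩
      1ℚ ℚ.+ ℚ.∣ seq x N ∣                         ∎
      where open ℚ.≤-Reasoning

  *-mono-≤-∣∣ : ∀ p q {b d} → ℚ.∣ p ∣ ℚ.≤ b → ℚ.∣ q ∣ ℚ.≤ d → ℚ.∣ p ℚ.* q ∣ ℚ.≤ b ℚ.* d
  *-mono-≤-∣∣ p q {b} {d} p≤b q≤d = begin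
    ℚ.∣ p ℚ.* q ∣          ≡⟨ ℚ.∣p*q∣≡∣p∣*∣q∣ p q ⟩
    ℚ.∣ p ∣ ℚ.* ℚ.∣ q ∣    ≤⟨ ℚ.*-monoʳ-≤-nonNeg ℚ.∣ q ∣ {{ℚ.∣-∣-nonNeg q}} p≤b ⟩
    b ℚ.* ℚ.∣ q ∣          ≤⟨ ℚ.*-monoˡ-≤-nonNeg b {{ℚ.nonNegative (ℚ.≤-trans (ℚ.0≤∣p∣ p) p≤b)}} q≤d ⟩
    b ℚ.* d                ∎
    where open ℚ.≤-Reasoning

_*ᴿ_ : ℝ → ℝ → ℝ
x *ᴿ y = mkℝ (λ n → seq x n ℚ.* seq y n) cauchy-*
  where
  cauchy-* : ∀ ε → 0ℚ ℚ.< ε → ∃[ N ] (∀ m n → N ℕ.≤ m → N ℕ.≤ n →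
             ℚ.∣ seq x m ℚ.* seq y m ℚ.- seq x n ℚ.* seq y n ∣ ℚ.≤ ε)
  cauchy-* ε 0<ε with eventuallyBounded x | eventuallyBounded y
  ... | B , 0<B , N₁ , bx | C , 0<C , N₂ , by = N , close
    where
    0<B+C : 0ℚ ℚ.< B ℚ.+ C
    0<B+C = ℚ.+-mono-< 0<B 0<C

    instance
      B+C-pos : ℚ.Positive (B ℚ.+ C)
      B+C-pos = ℚ.positive 0<B+C

      B+C-nonZero : ℚ.NonZero (B ℚ.+ C)
      B+C-nonZero = ℚ.pos⇒nonZero (B ℚ.+ C)

      inv-pos : ℚ.Positive (ℚ.1/ (B ℚ.+ C))
      inv-pos = ℚ.1/pos⇒pos (B ℚ.+ C)

      ε-pos : ℚ.Positive ε
      ε-pos = ℚ.positive 0<ε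

    δ : ℚ
    δ = ℚ.1/ (B ℚ.+ C) ℚ.* ε

    0<δ : 0ℚ ℚ.< δ
    0<δ = ℚ.positive⁻¹ δ {{ℚ.pos*pos⇒pos (ℚ.1/ (B ℚ.+ C)) ε}}

    Bδ+Cδ≡ε : B ℚ.* δ ℚ.+ C ℚ.* δ ≡ ε
    Bδ+Cδ≡ε = begin
      B ℚ.* δ ℚ.+ C ℚ.* δ                      ≡⟨ ℚ.*-distribʳ-+ δ B C ⟨
      (B ℚ.+ C) ℚ.* δ                          ≡⟨ ℚ.*-assoc (B ℚ.+ C) (ℚ.1/ (B ℚ.+ C)) ε ⟨
      ((B ℚ.+ C) ℚ.* ℚ.1/ (B ℚ.+ C)) ℚ.* ε     ≡⟨ cong (ℚ._* ε) (ℚ.*-inverseʳ (B ℚ.+ C)) ⟩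
      1ℚ ℚ.* ε                                 ≡⟨ ℚ.*-identityˡ ε ⟩
      ε                                        ∎
      where open ≡-Reasoning

    N₃ N₄ N : ℕ
    N₃ = proj₁ (cauchy x δ 0<δ)
    N₄ = proj₁ (cauchy y δ 0<δ)
    N = (N₁ ℕ.⊔ N₂) ℕ.⊔ (N₃ ℕ.⊔ N₄)

    N₁≤N : N₁ ℕ.≤ N
    N₁≤N = ℕ.≤-trans (ℕ.m≤m⊔n N₁ N₂) (ℕ.m≤m⊔n _ (N₃ ℕ.⊔ N₄))
    N₂≤N : N₂ ℕ.≤ N
    N₂≤N = ℕ.≤-trans (ℕ.m≤n⊔m N₁ N₂) (ℕ.m≤m⊔n _ (N₃ ℕ.⊔ N₄))
    N₃≤N : N₃ ℕ.≤ N
    N₃≤N = ℕ.≤-trans (ℕ.m≤m⊔n N₃ N₄) (ℕ.m≤n⊔m (N₁ ℕ.⊔ N₂) _)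
    N₄≤N : N₄ ℕ.≤ N
    N₄≤N = ℕ.≤-trans (ℕ.m≤n⊔m N₃ N₄) (ℕ.m≤n⊔m (N₁ ℕ.⊔ N₂) _)

    distrib-∸ : ∀ a b c → a ℚ.* (b ℚ.- c) ≡ a ℚ.* b ℚ.- a ℚ.* c
    distrib-∸ a b c = trans (ℚ.*-distribˡ-+ a b (ℚ.- c))
                            (cong (a ℚ.* b ℚ.+_) (sym (ℚ.neg-distribʳ-* a c)))

    rearrange : ∀ a b c d → a ℚ.* b ℚ.- c ℚ.* d ≡ a ℚ.* (b ℚ.- d) ℚ.+ d ℚ.* (a ℚ.- c)
    rearrange a b c d = begin
      a ℚ.* b ℚ.- c ℚ.* d
        ≡⟨ cong (ℚ._- c ℚ.* d) (split (a ℚ.* b) (a ℚ.* d)) ⟩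
      ((a ℚ.* b ℚ.- a ℚ.* d) ℚ.+ a ℚ.* d) ℚ.- c ℚ.* d
        ≡⟨ ℚ.+-assoc (a ℚ.* b ℚ.- a ℚ.* d) (a ℚ.* d) (ℚ.- (c ℚ.* d)) ⟩
      (a ℚ.* b ℚ.- a ℚ.* d) ℚ.+ (a ℚ.* d ℚ.- c ℚ.* d)
        ≡⟨ cong₂ ℚ._+_ (distrib-∸ a b d)
             (trans (distrib-∸ d a c) (cong₂ ℚ._-_ (ℚ.*-comm d a) (ℚ.*-comm d c))) ⟨
      a ℚ.* (b ℚ.- d) ℚ.+ d ℚ.* (a ℚ.- c) ∎
      where open ≡-Reasoning

    close : ∀ m n → N ℕ.≤ m → N ℕ.≤ n →
            ℚ.∣ seq x m ℚ.* seq y m ℚ.- seq x n ℚ.* seq y n ∣ ℚ.≤ ε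
    close m n N≤m N≤n = begin
      ℚ.∣ xₘ ℚ.* yₘ ℚ.- xₙ ℚ.* yₙ ∣
        ≡⟨ cong ℚ.∣_∣ (rearrange xₘ yₘ xₙ yₙ) ⟩
      ℚ.∣ xₘ ℚ.* (yₘ ℚ.- yₙ) ℚ.+ yₙ ℚ.* (xₘ ℚ.- xₙ) ∣
        ≤⟨ ℚ.∣p+q∣≤∣p∣+∣q∣ (xₘ ℚ.* (yₘ ℚ.- yₙ)) (yₙ ℚ.* (xₘ ℚ.- xₙ)) ⟩
      ℚ.∣ xₘ ℚ.* (yₘ ℚ.- yₙ) ∣ ℚ.+ ℚ.∣ yₙ ℚ.* (xₘ ℚ.- xₙ) ∣
        ≤⟨ ℚ.+-mono-≤
             (*-mono-≤-∣∣ xₘ (yₘ ℚ.- yₙ) (bx m (ℕ.≤-trans N₁≤N N≤m))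
               (proj₂ (cauchy y δ 0<δ) m n (ℕ.≤-trans N₄≤N N≤m) (ℕ.≤-trans N₄≤N N≤n)))
             (*-mono-≤-∣∣ yₙ (xₘ ℚ.- xₙ) (by n (ℕ.≤-trans N₂≤N N≤n))
               (proj₂ (cauchy x δ 0<δ) m n (ℕ.≤-trans N₃≤N N≤m) (ℕ.≤-trans N₃≤N N≤n))) ⟩
      B ℚ.* δ ℚ.+ C ℚ.* δ
        ≡⟨ Bδ+Cδ≡ε ⟩
      ε ∎
      where
      open ℚ.≤-Reasoning
      xₘ xₙ yₘ yₙ : ℚ
      xₘ = seq x m
      xₙ = seq x n
      yₘ = seq y m
      yₙ = seq y n

-- The symbols are drawn from one countably infinite supply, so
-- that every dataset uses a finite alphabet, of any size, and leaves
-- symbols unused.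
Symbol : Set
Symbol = ℕ

Str : Set
Str = List Symbol

infix 4 _⊑_

_⊑_ : Str → Str → Set
_⊑_ = Infix _≡_

length# : Symbol → Str → ℕ
length# # s = length (filter (ℕ._≟ #) s)

record Overlap (s t : Str) : Set where
  field
    front str back : Str
    left    : s ≡ front ++ str
    right   : t ≡ str ++ back
    longest : ∀ x y z → s ≡ x ++ y → t ≡ y ++ z → length y ℕ.≤ length str

open Overlap public

findOverlap : ∀ s t → Overlap s t
findOverlap [] t = record
  { front = [] ; str = [] ; back = t ; left = refl ; right = refl
  ; longest = λ x y z p _ → ℕ.≤-reflexive (cong length (++-conicalʳ x y (sym p)))
  }
findOverlap (a ∷ s) t with prefix? ℕ._≟_ (a ∷ s) t
... | yes p with Prefix.toView p
...   | a∷s≋ Prefix.++ z with refl ← Pointwise-≡⇒≡ a∷s≋ = record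
  { front = [] ; str = a ∷ s ; back = z ; left = refl ; right = refl
  ; longest = λ x y _ q _ → subst (length y ℕ.≤_)
      (trans (sym (length-++ x)) (cong length (sym q))) (ℕ.m≤n+m (length y) (length x))
  }
findOverlap (a ∷ s) t | no ¬p = record
  { front = a ∷ front o ; str = str o ; back = back o
  ; left = cong (a ∷_) (left o) ; right = right o
  ; longest = λ where
      []      y z q r → ⊥-elim (¬p (subst₂ (Prefix _≡_) (sym q) (sym r)
                          (Prefix.fromView (≡⇒Pointwise-≡ refl Prefix.++ z))))
      (_ ∷ x) y z q r → longest o x y z (∷-injectiveʳ q) r
  }
  where
  o : Overlap s t
  o = findOverlap s t

overlapOf : Str → Str → Str
overlapOf s t = str (findOverlap s t)

merge : Str → Str → Str
merge s t = front o ++ str o ++ back o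
  where
  o : Overlap s t
  o = findOverlap s t

record Dataset (S : List Str) : Set where
  field
    nonEmpty      : S ≢ []
    unique        : Unique S
    substringFree : ∀ {s t} → s ∈ S → t ∈ S → s ≢ t → ¬ (s ⊑ t)

Superstring : List Str → Str → Set
Superstring S w = All (_⊑ w) S

Optimal : (Str → ℕ) → List Str → Str → Set
Optimal ∥_∥ S w = Superstring S w × (∀ v → Superstring S v → ∥ w ∥ ℕ.≤ ∥ v ∥)

-- Which ordered pairs may be merged when R is the list of remaining strings.
Rule : Set₁
Rule = List Str → Str → Str → Set

-- (s , t) is an ordered pair of strings at different positions of R.  In a
-- run that starts from a dataset no string ever occurs twice in R: every
-- remaining string begins with some string of the dataset, and different
-- remaining strings begin with different ones.  So these are exactly the
-- ordered pairs of distinct remaining strings.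
Pair : Rule
Pair R s t = ∃[ Q ] R ↭ s ∷ t ∷ Q

Longest : Rule
Longest R s t =
  ∀ s′ t′ → Pair R s′ t′ → length (overlapOf s′ t′) ℕ.≤ length (overlapOf s t)

Longest# : Symbol → Rule
Longest# # R s t =
  ∀ s′ t′ → Pair R s′ t′ → length# # (overlapOf s′ t′) ℕ.≤ length# # (overlapOf s t)

LongestAmongLongest# : Symbol → Rule
LongestAmongLongest# # R s t =
  ∀ s′ t′ → Pair R s′ t′ → Longest# # R s′ t′ →
    length (overlapOf s′ t′) ℕ.≤ length (overlapOf s t)

data Run (rule : Rule) : List Str → Str → Set where
  stop : ∀ {s} → Run rule (s ∷ []) s
  step : ∀ {R s t Q w} → R ↭ s ∷ t ∷ Q → rule R s t →
         Run rule (merge s t ∷ Q) w → Run rule R w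

data EveryStep (P : Rule) {rule : Rule} : ∀ {R w} → Run rule R w → Set where
  stop : ∀ {s} → EveryStep P (stop {s = s})
  step : ∀ {R s t Q w} {R↭ : R ↭ s ∷ t ∷ Q} {best : rule R s t}
           {rest : Run rule (merge s t ∷ Q) w} →
         P R s t → EveryStep P rest → EveryStep P (step R↭ best rest)

-- A dataset is a set: the output may not depend on how it is listed.
record Instantiation (rule : Rule) : Set where
  field
    output  : List Str → Str
    respect : ∀ {S T} → Dataset S → S ↭ T → output S ≡ output T
    run     : ∀ {S} → Dataset S → Run rule S (output S)

open Instantiation public

GA : Set
GA = Instantiation Longest

GA# : Set
GA# = (# : Symbol) → Instantiation (Longest# #)

MergesLongest : GA# → Set
MergesLongest A =
  ∀ # {S} (d : Dataset S) → EveryStep (LongestAmongLongest# #) (run (A #) d)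

ApproximateFor : ∀ {rule} → ℝ → (Str → ℕ) → Instantiation rule → Set
ApproximateFor c ∥_∥ A =
  ∀ S w → Dataset S → Optimal ∥_∥ S w → fromℕ ∥ output A S ∥ ≤ᴿ c *ᴿ fromℕ ∥ w ∥

Approximate : ℝ → GA → Set
Approximate c A = ApproximateFor c length A

Approximate# : ℝ → GA# → Set
Approximate# c A = ∀ # → ApproximateFor c (length# #) (A #)

{-# OPTIONS --safe #-}
module Submission where

-- Both parts transfer a run of one algorithm (the source) to every run of the
-- other (the target) by re-encoding the dataset.  A symbol a becomes a block
-- whose middle is 0^κ(a), blocks are separated by 0^m, and the i-th string gets
-- individual paddings 0^α and 0^β at its ends.  With κ(a) = K·μ(a) and K large
-- the encoded overlaps are ordered first by the source weight μ, then by length,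
-- and only then by the paddings, which are chosen along the given source run so
-- that its next pair is always the unique best one.  Hence the target merges the
-- same pairs, weights are multiplied by K up to an error independent of K, and
-- K → ∞ preserves the approximation factor.  In (a) μ is the length and the
-- target counts zeros; in (b) μ counts # and the target measures length.

open import Defs
open import Data.Empty using (⊥; ⊥-elim)
import Data.Integer.Base as ℤ
import Data.Integer.Properties as ℤ
open import Data.List.Base using (List; []; _∷_; _++_; length; replicate; map; concatMap; filter)
open import Data.List.Extrema.Nat using (argmax; f[xs]≤f[argmax])
open import Data.List.Membership.Propositional using (_∈_)
open import Data.List.Membership.Propositional.Properties using (∈-∃++)
open import Data.List.Properties
  using (++-assoc; ++-identityʳ; ++-cancelˡ; length-++; length-replicate; filter-++;
         ∷-injective; ∷-injectiveʳ; map-∘; map-id)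
open import Data.List.Relation.Binary.Infix.Heterogeneous using (MkView; toView; fromView)
import Data.List.Relation.Binary.Lex.NonStrict as Lex
open import Data.List.Relation.Binary.Permutation.Propositional
  using (_↭_; ↭-refl; ↭-sym; ↭-trans; prep; swap; ↭⇒↭ₛ; ↭⇒↭ₛ′)
open import Data.List.Relation.Binary.Permutation.Propositional.Properties
  using (↭-map-inv; ↭-length; ∈-resp-↭; All-resp-↭; drop-∷; shift; ↭-empty-inv; ↭-singleton-inv)
  renaming (map⁺ to ↭-map⁺)
import Data.List.Relation.Binary.Permutation.Setoid.Properties as ↭ₛ
open import Data.List.Relation.Binary.Pointwise as Pointwise using (Pointwise-≡⇒≡; ≡⇒Pointwise-≡)
open import Data.List.Relation.Unary.All as All using (All; []; _∷_)
open import Data.List.Relation.Unary.All.Properties using () renaming (map⁻ to All-map⁻; map⁺ to All-map⁺)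
open import Data.List.Relation.Unary.AllPairs as AllPairs using (AllPairs; []; _∷_)
import Data.List.Relation.Unary.AllPairs.Properties as AllPairs
open import Data.List.Relation.Unary.Any as Any using (Any; here; there)
import Data.List.Relation.Unary.Any.Properties as Any
open import Data.List.Relation.Unary.Sorted.TotalOrder.Properties using (↗↭↗⇒≋)
open import Data.Nat.Base as ℕ using (ℕ; zero; suc; _+_; _*_; _∸_; _⊓_; _≤_; _<_; z≤n; s≤s)
open import Data.Nat.ListAction using (sum)
open import Data.Nat.Properties as ℕ
open import Data.Nat.Solver using (module +-*-Solver)
open import Data.Product.Base using (∃-syntax; _×_; _,_; proj₁; proj₂)
open import Data.Rational.Base as ℚ using (ℚ; mkℚ; 0ℚ; 1ℚ; toℚᵘ)
import Data.Rational.Properties as ℚ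
import Data.Rational.Solver as ℚ-Solver
open import Data.Rational.Unnormalised.Base as ℚᵘ using (mkℚᵘ; *≡*; *≤*)
import Data.Rational.Unnormalised.Properties as ℚᵘ
open import Data.Sum.Base using (_⊎_; inj₁; inj₂)
open import Function.Base using (id)
open import Relation.Binary.Bundles using (DecTotalOrder)
open import Relation.Binary.PropositionalEquality
open import Relation.Nullary using (¬_; yes; no)

-- Overlaps and merges

++-compare : ∀ a {b} c {d : Str} → a ++ b ≡ c ++ d →
             (∃[ e ] c ≡ a ++ e × b ≡ e ++ d) ⊎ (∃[ e ] a ≡ c ++ e × d ≡ e ++ b)
++-compare []      c       p = inj₁ (c , refl , p)
++-compare (x ∷ a) []      p = inj₂ (x ∷ a , refl , sym p)
++-compare (x ∷ a) (y ∷ c) p with ∷-injective p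
... | refl , q with ++-compare a c q
...   | inj₁ (e , r , t) = inj₁ (e , cong (x ∷_) r , t)
...   | inj₂ (e , r , t) = inj₂ (e , cong (x ∷_) r , t)

⊑⇒++ : ∀ {s t} → s ⊑ t → ∃[ x ] ∃[ z ] t ≡ x ++ s ++ z
⊑⇒++ s⊑t with MkView x s≋ z ← toView s⊑t with refl ← Pointwise-≡⇒≡ s≋ = x , z , refl

++⇒⊑ : ∀ {s t} x z → t ≡ x ++ s ++ z → s ⊑ t
++⇒⊑ x z refl = fromView (MkView x (≡⇒Pointwise-≡ refl) z)

suffix⇒⊑ : ∀ {s t} x → t ≡ x ++ s → s ⊑ t
suffix⇒⊑ {s} x refl = ++⇒⊑ x [] (cong (x ++_) (sym (++-identityʳ s)))

prefix⇒⊑ : ∀ {s t} z → t ≡ s ++ z → s ⊑ t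
prefix⇒⊑ z p = ++⇒⊑ [] z p

⊑-refl : ∀ {s} → s ⊑ s
⊑-refl = suffix⇒⊑ [] refl

⊑-trans : ∀ {s t u} → s ⊑ t → t ⊑ u → s ⊑ u
⊑-trans {s} s⊑t t⊑u with ⊑⇒++ s⊑t | ⊑⇒++ t⊑u
... | x , z , refl | x′ , z′ , refl = ++⇒⊑ (x′ ++ x) (z ++ z′) (begin
  x′ ++ (x ++ s ++ z) ++ z′   ≡⟨ cong (x′ ++_) (++-assoc x (s ++ z) z′) ⟩
  x′ ++ x ++ (s ++ z) ++ z′   ≡⟨ cong (λ w → x′ ++ x ++ w) (++-assoc s z z′) ⟩
  x′ ++ x ++ s ++ z ++ z′     ≡⟨ ++-assoc x′ x _ ⟨
  (x′ ++ x) ++ s ++ z ++ z′   ∎)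
  where open ≡-Reasoning

suffix-length : ∀ {s} x {y : Str} → s ≡ x ++ y → length y ≤ length s
suffix-length x {y} refl = ≤-trans (m≤n+m (length y) (length x)) (≤-reflexive (sym (length-++ x)))

suffix-of-suffix : ∀ {x₁ y₁ x₂ y₂ : Str} → x₁ ++ y₁ ≡ x₂ ++ y₂ → length y₁ ≤ length y₂ →
                   ∃[ p ] y₂ ≡ p ++ y₁
suffix-of-suffix {x₁} {y₁} {x₂} {y₂} eq le with ++-compare x₁ x₂ eq
... | inj₂ (p , _ , q) = p , q
... | inj₁ ([] , _ , q) = [] , sym q
... | inj₁ (a ∷ p , _ , refl) = ⊥-elim (<⇒≱ (s≤s (suffix-length p refl)) le)

overlapOf-unique : ∀ {s t} x y z → s ≡ x ++ y → t ≡ y ++ z →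
  (∀ x′ y′ z′ → s ≡ x′ ++ y′ → t ≡ y′ ++ z′ → length y′ ≤ length y) → overlapOf s t ≡ y
overlapOf-unique {s} {t} x y z p q max = go
  (suffix-of-suffix {front o} {str o} {x} (trans (sym (left o)) p)
    (max (front o) (str o) (back o) (left o) (right o)))
  where
  o : Overlap s t
  o = findOverlap s t

  go : ∃[ e ] y ≡ e ++ str o → str o ≡ y
  go ([] , e) = sym e
  go (a ∷ e , r) = ⊥-elim (<⇒≱ (s≤s (suffix-length e refl))
                     (≤-trans (≤-reflexive (cong length (sym r))) (longest o x y z p q)))

merge≡s++back : ∀ s t → merge s t ≡ s ++ back (findOverlap s t)
merge≡s++back s t = trans (sym (++-assoc (front o) (str o) (back o))) (cong (_++ back o) (sym (left o)))
  where
  o : Overlap s t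
  o = findOverlap s t

merge≡front++t : ∀ s t → merge s t ≡ front (findOverlap s t) ++ t
merge≡front++t s t = cong (front o ++_) (sym (right o))
  where
  o : Overlap s t
  o = findOverlap s t

s⊑merge : ∀ s t → s ⊑ merge s t
s⊑merge s t = prefix⇒⊑ _ (merge≡s++back s t)

overlapOf-mergeˡ : ∀ s t {q} → ¬ (t ⊑ q) → overlapOf (merge s t) q ≡ overlapOf t q
overlapOf-mergeˡ s t {q} t⋢q = overlapOf-unique (f ++ front o) (str o) (back o)
  (trans (merge≡front++t s t) (trans (cong (f ++_) (left o)) (sym (++-assoc f (front o) (str o)))))
  (right o)
  (λ x y z p r → go x y z (++-compare f x (trans (sym (merge≡front++t s t)) p)) r)
  where
  f : Str
  f = front (findOverlap s t)

  o : Overlap t q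
  o = findOverlap t q

  go : ∀ x y z → (∃[ e ] x ≡ f ++ e × t ≡ e ++ y) ⊎ (∃[ e ] f ≡ x ++ e × y ≡ e ++ t) →
       q ≡ y ++ z → length y ≤ length (str o)
  go x y z (inj₁ (e , _ , p)) r = longest o e y z p r
  go x y z (inj₂ (e , _ , refl)) r = ⊥-elim (t⋢q (++⇒⊑ e z (trans r (++-assoc e t z))))

overlapOf-mergeʳ : ∀ s t {q} → ¬ (s ⊑ q) → overlapOf q (merge s t) ≡ overlapOf q s
overlapOf-mergeʳ s t {q} s⋢q = overlapOf-unique (front o) (str o) (back o ++ b)
  (left o)
  (trans (merge≡s++back s t) (trans (cong (_++ b) (right o)) (++-assoc (str o) (back o) b)))
  (λ x y z p r → go x y z p (++-compare s y (trans (sym (merge≡s++back s t)) r)))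
  where
  b : Str
  b = back (findOverlap s t)

  o : Overlap q s
  o = findOverlap q s

  go : ∀ x y z → q ≡ x ++ y → (∃[ e ] y ≡ s ++ e × b ≡ e ++ z) ⊎ (∃[ e ] s ≡ y ++ e × z ≡ e ++ b) →
       length y ≤ length (str o)
  go x y z p (inj₁ (e , refl , _)) = ⊥-elim (s⋢q (++⇒⊑ x e p))
  go x y z p (inj₂ (e , r , _)) = longest o x y e p r

-- An occurrence of q in merge s t lying in neither s nor t begins inside s,
-- covers the overlap and ends inside t, so s and q overlap by more than s and t.
⋢-merge : ∀ {s t q} → ¬ (q ⊑ s) → ¬ (q ⊑ t) →
          length (overlapOf s q) ≤ length (overlapOf s t) → ¬ (q ⊑ merge s t)
⋢-merge {s} {t} {q} q⋢s q⋢t le q⊑m with ⊑⇒++ q⊑m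
... | a , b , p = go₁ (++-compare a f (trans (sym p) (merge≡front++t s t)))
  where
  o : Overlap s t
  o = findOverlap s t

  f : Str
  f = front o

  go₃ : ∀ e r → f ≡ a ++ e → q ≡ (e ++ str o) ++ r → back o ≡ r ++ b → length e ≡ 0 → q ⊑ t
  go₃ [] r _ refl z≡ _ = prefix⇒⊑ b
    (trans (right o) (trans (cong (str o ++_) z≡) (sym (++-assoc (str o) r b))))

  go₂ : ∀ e → f ≡ a ++ e →
        (∃[ r ] e ++ str o ≡ q ++ r × b ≡ r ++ back o) ⊎ (∃[ r ] q ≡ (e ++ str o) ++ r × back o ≡ r ++ b) →
        q ⊑ t
  go₂ e f≡ (inj₁ (r , eq , _)) = ⊥-elim (q⋢s (++⇒⊑ a r
    (trans (left o) (trans (cong (_++ str o) f≡) (trans (++-assoc a e (str o)) (cong (a ++_) eq))))))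
  go₂ e f≡ (inj₂ (r , eq , z≡)) = go₃ e r f≡ eq z≡ (n≤0⇒n≡0 (+-cancelʳ-≤ (length (str o)) _ _
    (≤-trans (≤-reflexive (sym (length-++ e)))
      (≤-trans (longest (findOverlap s q) a (e ++ str o) r
                  (trans (left o) (trans (cong (_++ str o) f≡) (++-assoc a e (str o)))) eq)
        le))))

  go₁ : (∃[ e ] f ≡ a ++ e × q ++ b ≡ e ++ t) ⊎ (∃[ e ] a ≡ f ++ e × t ≡ e ++ q ++ b) → _
  go₁ (inj₂ (e , _ , eq)) = q⋢t (++⇒⊑ e b eq)
  go₁ (inj₁ (e , f≡ , eq)) = q⋢t (go₂ e f≡ (++-compare q (e ++ str o)
    (trans eq (trans (cong (e ++_) (right o)) (sym (++-assoc e (str o) (back o)))))))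

-- The encoding

pad : ℕ → Str
pad n = replicate n 0

pad-+ : ∀ m n → pad (m + n) ≡ pad m ++ pad n
pad-+ zero    n = refl
pad-+ (suc m) n = cong (0 ∷_) (pad-+ m n)

pad-split : ∀ {m n} → m ≤ n → pad n ≡ pad m ++ pad (n ∸ m)
pad-split {m} {n} m≤n = trans (cong pad (sym (m+[n∸m]≡n m≤n))) (pad-+ m (n ∸ m))

pad-splitʳ : ∀ {m n} → m ≤ n → pad n ≡ pad (n ∸ m) ++ pad m
pad-splitʳ {m} {n} m≤n = trans (cong pad (sym (m∸n+n≡m m≤n))) (pad-+ (n ∸ m) m)

pad-suffix : ∀ n x {y} → pad n ≡ x ++ y → ∃[ j ] j ≤ n × y ≡ pad j
pad-suffix n       []      p = n , ≤-refl , sym p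
pad-suffix (suc n) (_ ∷ x) p with pad-suffix n x (∷-injectiveʳ p)
... | j , j≤n , q = j , m≤n⇒m≤1+n j≤n , q

pad-cancel : ∀ j k {a b r r′} → pad j ++ suc a ∷ r ≡ pad k ++ suc b ∷ r′ →
             j ≡ k × suc a ∷ r ≡ suc b ∷ r′
pad-cancel zero    zero    p = refl , p
pad-cancel (suc j) (suc k) p with pad-cancel j k (∷-injectiveʳ p)
... | refl , q = refl , q

pad-prefix : ∀ j k {a r z} → pad j ++ z ≡ pad k ++ suc a ∷ r → j ≤ k
pad-prefix zero    k       p = z≤n
pad-prefix (suc j) (suc k) p = s≤s (pad-prefix j k (∷-injectiveʳ p))

pad≢ : ∀ j k {a r} → pad j ≢ pad k ++ suc a ∷ r
pad≢ zero    zero    ()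
pad≢ (suc j) zero    ()
pad≢ (suc j) (suc k) p = pad≢ j k (∷-injectiveʳ p)

-- Writing α ⊓ β zeros for the empty word makes the longest overlap of
-- encode α s β and encode α′ t β′ equal to encode α′ y β, where y is that of
-- s and t, even when y is empty.
module Encoding (κ : Symbol → ℕ) (m : ℕ) where

  block : ℕ → Symbol → Str → Str
  block α a s = pad α ++ (2 + a) ∷ pad (κ a) ++ 1 ∷ s

  block-++ : ∀ α a s t → block α a s ++ t ≡ block α a (s ++ t)
  block-++ α a s t = trans (++-assoc (pad α) _ t)
    (cong (λ w → pad α ++ (2 + a) ∷ w) (++-assoc (pad (κ a)) _ t))

  encode : ℕ → Str → ℕ → Str
  encode α []      β = pad (α ⊓ β)
  encode α (a ∷ s) β = block α a (encode m s β)

  encode-suffix : ∀ {α α′ β} x y → α′ ≤ α → α′ ≤ m →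
                  ∃[ p ] encode α (x ++ y) β ≡ p ++ encode α′ y β
  encode-suffix {β = β} [] [] α′≤α _ = _ , pad-splitʳ (⊓-monoˡ-≤ β α′≤α)
  encode-suffix {α} {α′} [] (a ∷ y) α′≤α _ = pad (α ∸ α′) ,
    trans (cong (_++ _) (pad-splitʳ α′≤α)) (++-assoc (pad (α ∸ α′)) (pad α′) _)
  encode-suffix {α} {α′} {β} (a ∷ x) y α′≤α α′≤m with encode-suffix {β = β} x y α′≤m α′≤m
  ... | p , eq = block α a p , trans (cong (block α a) eq) (sym (block-++ α a p _))

  encode-prefix : ∀ {α β β′} y z → z ≢ [] ⊎ β ≤ β′ →
                  ∃[ p ] encode α (y ++ z) β′ ≡ encode α y β ++ p
  encode-prefix {α} [] [] (inj₁ z≢[]) = ⊥-elim (z≢[] refl)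
  encode-prefix {α} [] [] (inj₂ β≤β′) = _ , pad-split (⊓-monoʳ-≤ α β≤β′)
  encode-prefix {α} {β} [] (c ∷ z) _ = pad (α ∸ α ⊓ β) ++ _ ,
    trans (cong (_++ _) (pad-split (m⊓n≤m α β))) (++-assoc (pad (α ⊓ β)) _ _)
  encode-prefix {α} (a ∷ y) z h with encode-prefix {m} y z h
  ... | p , eq = p , trans (cong (block α a) eq) (sym (block-++ α a _ p))

  encode-mono-⊑ : ∀ {s w α β} → α ≤ m → β ≤ m → s ⊑ w → encode α s β ⊑ encode m w m
  encode-mono-⊑ {s} α≤m β≤m s⊑w with ⊑⇒++ s⊑w
  ... | x , z , refl = ⊑-trans
    (prefix⇒⊑ _ (proj₂ (encode-prefix s z (inj₂ β≤m))))
    (suffix⇒⊑ _ (proj₂ (encode-suffix x (s ++ z) α≤m α≤m)))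

  data Cut (t : Str) (β : ℕ) (y : Str) : Set where
    inPadding   : ∀ j → j ≤ β → y ≡ pad j → Cut t β y
    beforeBlock : ∀ x j a u → t ≡ x ++ a ∷ u → y ≡ encode j (a ∷ u) β → Cut t β y
    insideBlock : ∀ j r → y ≡ pad j ++ 1 ∷ r → Cut t β y

  cut : ∀ α t β p {y} → p ++ y ≡ encode α t β → Cut t β y
  cut α [] β p eq with pad-suffix (α ⊓ β) p (sym eq)
  ... | j , j≤ , q = inPadding j (≤-trans j≤ (m⊓n≤n α β)) q
  cut α (a ∷ u) β p {y} eq with ++-compare p (pad α) eq
  ... | inj₁ (e , q , r) with pad-suffix α p q
  ...   | j , _ , e≡ = beforeBlock [] j a u refl (trans r (cong (_++ _) e≡))
  cut α (a ∷ u) β p {y} eq | inj₂ ([] , _ , r) = beforeBlock [] 0 a u refl (sym r)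
  cut α (a ∷ u) β p {y} eq | inj₂ (_ ∷ e , _ , r) with ++-compare e (pad (κ a)) (sym (∷-injectiveʳ r))
  ...   | inj₁ (f , q , r′) with pad-suffix (κ a) e q
  ...     | j , _ , f≡ = insideBlock j _ (trans r′ (cong (_++ _) f≡))
  cut α (a ∷ u) β p {y} eq | inj₂ (_ ∷ e , _ , r) | inj₂ ([] , _ , r′) = insideBlock 0 _ (sym r′)
  cut α (a ∷ u) β p {y} eq | inj₂ (_ ∷ e , _ , r) | inj₂ (_ ∷ f , _ , r′)
    with cut m u β f (sym (∷-injectiveʳ r′))
  ... | inPadding j j≤ q        = inPadding j j≤ q
  ... | beforeBlock x j b v q s = beforeBlock (a ∷ x) j b v (cong (a ∷_) q) s
  ... | insideBlock j r″ q      = insideBlock j r″ q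

  encode-prefix⁻¹ : ∀ {α′ β β′} j a u t z → encode j (a ∷ u) β ++ z ≡ encode α′ t β′ →
                    ∃[ r ] j ≡ α′ × t ≡ (a ∷ u) ++ r
  encode-prefix⁻¹ {α′} {β′ = β′} j a u [] z eq =
    ⊥-elim (pad≢ (α′ ⊓ β′) j (trans (sym eq) (++-assoc (pad j) _ z)))
  encode-prefix⁻¹ {α′} j a u (b ∷ t) z eq
    with pad-cancel j α′ (trans (sym (++-assoc (pad j) _ z)) eq)
  ... | refl , eq₁ with ∷-injective eq₁
  ...   | refl , eq₂ with ++-cancelˡ (pad (κ a)) _ _ (trans (sym (++-assoc (pad (κ a)) _ z)) eq₂)
  ...     | eq₃ with u
  ...       | []     = t , refl , refl
  ...       | c ∷ u′ with encode-prefix⁻¹ m c u′ t z (∷-injectiveʳ eq₃)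
  ...         | r , _ , q = r , refl , cong (a ∷_) q

  encode-cancel-⊑ : ∀ {α α′ β β′} s t → encode α s β ⊑ encode α′ t β′ → s ⊑ t
  encode-cancel-⊑ [] t _ = prefix⇒⊑ t refl
  encode-cancel-⊑ {α} {α′} {β} {β′} (b ∷ s) t e with ⊑⇒++ e
  ... | x , z , eq with cut α′ t β′ x (sym eq)
  ...   | inPadding j _ q = ⊥-elim (pad≢ j α (trans (sym q) (++-assoc (pad α) _ z)))
  ...   | insideBlock j r q with pad-cancel α j (trans (sym (++-assoc (pad α) _ z)) q)
  ...     | ()
  encode-cancel-⊑ {α} (b ∷ s) t e | x , z , eq | beforeBlock x′ j a u t≡ q
    with encode-prefix⁻¹ α b s (a ∷ u) z q
  ... | r , _ , q′ = ++⇒⊑ x′ r (trans t≡ (cong (x′ ++_) q′))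

  overlapOf-encode : ∀ {s t α α′ β β′} → α′ ≤ m → ¬ (s ⊑ t) → ¬ (t ⊑ s) →
    overlapOf (encode α s β) (encode α′ t β′) ≡ encode α′ (overlapOf s t) β
  overlapOf-encode {s} {t} {α} {α′} {β} {β′} α′≤m s⋢t t⋢s =
    overlapOf-unique (proj₁ suf) (encode α′ y β) (proj₁ pre) (proj₂ suf) (proj₂ pre) max
    where
    o : Overlap s t
    o = findOverlap s t

    y : Str
    y = str o

    back≢[] : back o ≢ []
    back≢[] b≡ = t⋢s (suffix⇒⊑ (front o) (trans (left o) (cong (front o ++_)
      (sym (trans (right o) (trans (cong (y ++_) b≡) (++-identityʳ y)))))))

    suffix : ∀ x → s ≡ x ++ y → ∃[ p ] encode α s β ≡ p ++ encode α′ y β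
    suffix []      s≡ = ⊥-elim (s⋢t (prefix⇒⊑ (back o) (trans (right o) (cong (_++ back o) (sym s≡)))))
    suffix (a ∷ x) s≡ with encode-suffix {β = β} x y α′≤m α′≤m
    ... | p , eq = block α a p ,
      trans (cong (λ w → encode α w β) s≡) (trans (cong (block α a) eq) (sym (block-++ α a p _)))

    suf : ∃[ p ] encode α s β ≡ p ++ encode α′ y β
    suf = suffix (front o) (left o)

    pre : ∃[ p ] encode α′ t β′ ≡ encode α′ y β ++ p
    pre with encode-prefix {α′} {β} {β′} y (back o) (inj₁ back≢[])
    ... | p , eq = p , trans (cong (λ w → encode α′ w β′) (right o)) eq

    bound : ∀ u p → y ≡ p ++ u → length (encode α′ u β) ≤ length (encode α′ y β)
    bound u p y≡ with encode-suffix {β = β} p u (≤-refl {α′}) α′≤m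
    ... | q , eq = suffix-length q (trans (cong (λ w → encode α′ w β) y≡) eq)

    pad-bound : ∀ j t → ∀ {z} → pad j ++ z ≡ encode α′ t β′ → j ≤ α′
    pad-bound j [] {z} eq = ≤-trans (subst₂ _≤_ (length-replicate j)
      (trans (cong length eq) (length-replicate (α′ ⊓ β′)))
      (≤-trans (m≤m+n _ (length z)) (≤-reflexive (sym (length-++ (pad j)))))) (m⊓n≤m α′ β′)
    pad-bound j (b ∷ t) eq = pad-prefix j α′ eq

    ¬insideBlock : ∀ j t {r z} → (pad j ++ 1 ∷ r) ++ z ≡ encode α′ t β′ → ⊥
    ¬insideBlock j [] eq = pad≢ (α′ ⊓ β′) j (trans (sym eq) (++-assoc (pad j) _ _))
    ¬insideBlock j (b ∷ t) eq with pad-cancel j α′ (trans (sym (++-assoc (pad j) _ _)) eq)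
    ... | ()

    max : ∀ x y′ z → encode α s β ≡ x ++ y′ → encode α′ t β′ ≡ y′ ++ z →
          length y′ ≤ length (encode α′ y β)
    max x y′ z eq eq′ with cut α s β x (sym eq)
    ... | inPadding j j≤β refl = ≤-trans
      (≤-trans (≤-reflexive (length-replicate j))
        (≤-trans (⊓-glb (pad-bound j t (sym eq′)) j≤β) (≤-reflexive (sym (length-replicate (α′ ⊓ β))))))
      (bound [] y (sym (++-identityʳ y)))
    ... | insideBlock j r refl = ⊥-elim (¬insideBlock j t (sym eq′))
    ... | beforeBlock x′ j a u s≡ refl with encode-prefix⁻¹ j a u t z (sym eq′)
    ...   | r , refl , t≡ with suffix-of-suffix {x′} {a ∷ u} {front o} (trans (sym s≡) (left o))
                                (longest o x′ (a ∷ u) r s≡ t≡)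
    ...     | p , y≡ = bound (a ∷ u) p y≡

-- The forced run

Additive : (Str → ℕ) → Set
Additive μ = ∀ x y → μ (x ++ y) ≡ μ x + μ y

additive-[] : ∀ μ → Additive μ → μ [] ≡ 0
additive-[] μ μ-++ = sym (+-cancelˡ-≡ (μ []) 0 (μ []) (trans (+-identityʳ (μ [])) (μ-++ [] [])))

additive-merge : ∀ μ → Additive μ → ∀ s t → μ (merge s t) + μ (overlapOf s t) ≡ μ s + μ t
additive-merge μ μ-++ s t = begin
  μ (merge s t) + μ (str o)                       ≡⟨ cong (λ w → μ w + μ (str o)) (merge≡s++back s t) ⟩
  μ (s ++ back o) + μ (str o)                     ≡⟨ cong (_+ μ (str o)) (μ-++ s (back o)) ⟩
  μ s + μ (back o) + μ (str o)                    ≡⟨ +-assoc (μ s) _ _ ⟩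
  μ s + (μ (back o) + μ (str o))                  ≡⟨ cong (μ s +_) (+-comm (μ (back o)) (μ (str o))) ⟩
  μ s + (μ (str o) + μ (back o))                  ≡⟨ cong (μ s +_) (μ-++ (str o) (back o)) ⟨
  μ s + μ (str o ++ back o)                       ≡⟨ cong (λ w → μ s + μ w) (right o) ⟨
  μ s + μ t                                       ∎
  where
  open ≡-Reasoning
  o : Overlap s t
  o = findOverlap s t

LongestBy : (Str → ℕ) → Rule
LongestBy ν R s t = ∀ s′ t′ → Pair R s′ t′ → ν (overlapOf s′ t′) ≤ ν (overlapOf s t)

Below : (Str → ℕ) → Str → Str → Set
Below μ y ỹ = μ y < μ ỹ ⊎ (μ y ≤ μ ỹ × length y ≤ length ỹ)

LexLongest : (Str → ℕ) → Rule
LexLongest μ R s t = ∀ s′ t′ → Pair R s′ t′ → Below μ (overlapOf s′ t′) (overlapOf s t)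

-- Both overlaps are suffixes of s, so the longer one has the larger weight.
below⇒shorter : ∀ μ → Additive μ → ∀ s q t → Below μ (overlapOf s q) (overlapOf s t) →
                length (overlapOf s q) ≤ length (overlapOf s t)
below⇒shorter μ μ-++ s q t (inj₂ (_ , le)) = le
below⇒shorter μ μ-++ s q t (inj₁ lt) with length (overlapOf s q) ≤? length (overlapOf s t)
... | yes le = le
... | no ≰ with suffix-of-suffix {front (findOverlap s t)} {overlapOf s t} {front (findOverlap s q)}
                  (trans (sym (left (findOverlap s t))) (left (findOverlap s q))) (<⇒≤ (≰⇒> ≰))
...   | p , eq = ⊥-elim (<⇒≱ lt (≤-trans (m≤n+m _ (μ p))
                   (≤-reflexive (sym (trans (cong μ eq) (μ-++ p (overlapOf s t)))))))

record Lab : Set where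
  constructor lab
  field
    word     : Str
    lead end : ℕ

open Lab

-- The paddings that force the target run: the pair merged when T + 1 merges
-- remain gets padding T + 1 at its junction, more than any junction available later.
data Guided (μ : Str → ℕ) : ℕ → List Lab → Str → Set where
  stop : ∀ {s} → Guided μ 0 (lab s 0 0 ∷ []) s
  step : ∀ {T L s t α β Q w} → L ↭ lab s α (suc T) ∷ lab t (suc T) β ∷ Q →
         LexLongest μ (map word L) s t → Guided μ T (lab (merge s t) α β ∷ Q) w →
         Guided μ (suc T) L w

guided-bounds : ∀ {μ T L w} → Guided μ T L w → All (λ l → lead l ≤ T × end l ≤ T) L
guided-bounds stop = (z≤n , z≤n) ∷ []
guided-bounds (step L↭ _ rest) with guided-bounds rest
... | (α≤ , β≤) ∷ bs = All-resp-↭ (↭-sym L↭)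
  ((m≤n⇒m≤1+n α≤ , ≤-refl) ∷ (≤-refl , m≤n⇒m≤1+n β≤) ∷
   All.map (λ (x , y) → m≤n⇒m≤1+n x , m≤n⇒m≤1+n y) bs)

LexLongest-resp-↭ : ∀ μ {R R′} s t → R ↭ R′ → LexLongest μ R s t → LexLongest μ R′ s t
LexLongest-resp-↭ μ s t ρ best s′ t′ (Q , R′↭) = best s′ t′ (Q , ↭-trans ρ R′↭)

guide : ∀ {μ R w} → Run (LexLongest μ) R w → ∃[ T ] ∃[ L ] map word L ↭ R × Guided μ T L w
guide (stop {s}) = 0 , lab s 0 0 ∷ [] , ↭-refl , stop
guide {μ} (step {s = s} {t} R↭ best rest) with guide rest
... | T , L , L↭ , g with ↭-map-inv word L↭
...   | lab _ α β ∷ Q , refl , ρ = suc T , lab s α (suc T) ∷ lab t (suc T) β ∷ Q , ↭-sym R↭ ,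
          step ↭-refl (LexLongest-resp-↭ μ s t R↭ best) (guided-resp ρ g)
  where
  guided-resp : ∀ {μ T L L′ w} → L ↭ L′ → Guided μ T L w → Guided μ T L′ w
  guided-resp ρ stop with refl ← ↭-singleton-inv (↭-sym ρ) = stop
  guided-resp {μ} ρ (step {s = s} {t} L↭ best rest) =
    step (↭-trans (↭-sym ρ) L↭) (LexLongest-resp-↭ μ s t (↭-map⁺ word ρ) best) rest

AllPairs-resp-↭ : ∀ {A : Set} {R : A → A → Set} → (∀ {x y} → R x y → R y x) →
                  ∀ {xs ys} → xs ↭ ys → AllPairs R xs → AllPairs R ys
AllPairs-resp-↭ {A} {R} sym-R ρ = ↭ₛ.AllPairs-resp-↭ (setoid A) sym-R (resp₂ R) (↭⇒↭ₛ ρ)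

∈⇒↭ : ∀ {A : Set} {x : A} {xs} → x ∈ xs → ∃[ ys ] xs ↭ x ∷ ys
∈⇒↭ x∈ with ∈-∃++ x∈
... | as , bs , refl = as ++ bs , shift _ as bs

slack : ℕ → ℕ → ℕ → ℕ
slack Δ zero    err = err
slack Δ (suc T) err = slack Δ T (err + err + Δ)

module Simulation
  (μ ν : Str → ℕ) (μ-++ : Additive μ) (ν-++ : Additive ν)
  (bracket : ℕ) (ν-pad₁ : ν (0 ∷ []) ≡ 1) (ν-bracket : ∀ a → ν (2 + a ∷ []) + ν (1 ∷ []) ≡ bracket)
  (K m D : ℕ) (K-large : (bracket + m) * D < K)
  where

  open Encoding (λ a → K * μ (a ∷ [])) m public

  ν-pad : ∀ n → ν (pad n) ≡ n
  ν-pad zero    = additive-[] ν ν-++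
  ν-pad (suc n) = trans (ν-++ (0 ∷ []) (pad n)) (cong₂ _+_ ν-pad₁ (ν-pad n))

  ν-block : ∀ α a w → ν (block α a w) ≡ α + (bracket + K * μ (a ∷ []) + ν w)
  ν-block α a w = begin
    ν (block α a w)
      ≡⟨ ν-++ (pad α) _ ⟩
    ν (pad α) + ν ((2 + a ∷ []) ++ pad k ++ (1 ∷ []) ++ w)
      ≡⟨ cong₂ _+_ (ν-pad α) (trans (ν-++ (2 + a ∷ []) _) (cong (ν (2 + a ∷ []) +_)
           (trans (ν-++ (pad k) _) (cong₂ _+_ (ν-pad k) (ν-++ (1 ∷ []) w))))) ⟩
    α + (ν (2 + a ∷ []) + (k + (ν (1 ∷ []) + ν w)))
      ≡⟨ cong (α +_) (solve 4 (λ o k c w → o :+ (k :+ (c :+ w)) := o :+ c :+ k :+ w) refl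
           (ν (2 + a ∷ [])) k (ν (1 ∷ [])) (ν w)) ⟩
    α + (ν (2 + a ∷ []) + ν (1 ∷ []) + k + ν w)
      ≡⟨ cong (λ b → α + (b + k + ν w)) (ν-bracket a) ⟩
    α + (bracket + k + ν w) ∎
    where
    open ≡-Reasoning
    open +-*-Solver
    k : ℕ
    k = K * μ (a ∷ [])

  ν-encode-∷ : ∀ α a y {β} → β ≤ m →
    ν (encode α (a ∷ y) β) ≡ α + β + (K * μ (a ∷ y) + (bracket * suc (length y) + m * length y))
  ν-encode-∷ α a [] {β} β≤m = begin
    ν (encode α (a ∷ []) β)                        ≡⟨ ν-block α a _ ⟩
    α + (bracket + k + ν (pad (m ⊓ β)))            ≡⟨ cong (λ n → α + (bracket + k + n)) (trans (ν-pad (m ⊓ β)) (m≥n⇒m⊓n≡n β≤m)) ⟩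
    α + (bracket + k + β)                          ≡⟨ solve 5 (λ α b k β m → α :+ (b :+ k :+ β) := α :+ β :+ (k :+ (b :* con 1 :+ m :* con 0))) refl α bracket k β m ⟩
    α + β + (k + (bracket * 1 + m * 0))            ∎
    where
    open ≡-Reasoning
    open +-*-Solver
    k : ℕ
    k = K * μ (a ∷ [])
  ν-encode-∷ α a (b ∷ y) {β} β≤m = begin
    ν (encode α (a ∷ b ∷ y) β)
      ≡⟨ ν-block α a _ ⟩
    α + (bracket + K * μ (a ∷ []) + ν (encode m (b ∷ y) β))
      ≡⟨ cong (λ n → α + (bracket + K * μ (a ∷ []) + n)) (ν-encode-∷ m b y β≤m) ⟩
    α + (bracket + K * μ (a ∷ []) + (m + β + (K * μ (b ∷ y) + (bracket * suc l + m * l))))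
      ≡⟨ solve 8 (λ α c K x β m z l →
           α :+ (c :+ K :* x :+ (m :+ β :+ (K :* z :+ (c :* (con 1 :+ l) :+ m :* l))))
           := α :+ β :+ (K :* (x :+ z) :+ (c :* (con 2 :+ l) :+ m :* (con 1 :+ l)))) refl
           α bracket K (μ (a ∷ [])) β m (μ (b ∷ y)) l ⟩
    α + β + (K * (μ (a ∷ []) + μ (b ∷ y)) + (bracket * suc (suc l) + m * suc l))
      ≡⟨ cong (λ n → α + β + (K * n + (bracket * suc (suc l) + m * suc l))) (μ-++ (a ∷ []) (b ∷ y)) ⟨
    α + β + (K * μ (a ∷ b ∷ y) + (bracket * suc (suc l) + m * suc l)) ∎
    where
    open ≡-Reasoning
    open +-*-Solver
    l : ℕ
    l = length y

  ν-encode-lower : ∀ α y {β} → β ≤ m → K * μ y ≤ ν (encode α y β)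
  ν-encode-lower α [] _ = ≤-trans (≤-reflexive (trans (cong (K *_) (additive-[] μ μ-++)) (*-zeroʳ K))) z≤n
  ν-encode-lower α (a ∷ y) {β} β≤m = begin
    K * μ (a ∷ y)                        ≤⟨ m≤m+n _ _ ⟩
    K * μ (a ∷ y) + _                    ≤⟨ m≤n+m _ (α + β) ⟩
    α + β + (K * μ (a ∷ y) + _)          ≡⟨ ν-encode-∷ α a y β≤m ⟨
    ν (encode α (a ∷ y) β)               ∎
    where open ≤-Reasoning

  cost : Str → ℕ
  cost y = bracket * length y + m * length y

  ν-encode-upper : ∀ α y {β} → β ≤ m → ν (encode α y β) ≤ α + β + (K * μ y + cost y)
  ν-encode-upper α [] {β} _ = begin
    ν (pad (α ⊓ β))   ≡⟨ ν-pad (α ⊓ β) ⟩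
    α ⊓ β             ≤⟨ m⊓n≤m α β ⟩
    α                 ≤⟨ m≤m+n α β ⟩
    α + β             ≤⟨ m≤m+n (α + β) _ ⟩
    α + β + _         ∎
    where open ≤-Reasoning
  ν-encode-upper α (a ∷ y) {β} β≤m = begin
    ν (encode α (a ∷ y) β)
      ≡⟨ ν-encode-∷ α a y β≤m ⟩
    α + β + (K * μ (a ∷ y) + (bracket * suc (length y) + m * length y))
      ≤⟨ +-monoʳ-≤ (α + β) (+-monoʳ-≤ (K * μ (a ∷ y)) (+-monoʳ-≤ (bracket * suc (length y))
           (*-monoʳ-≤ m (n≤1+n (length y))))) ⟩
    α + β + (K * μ (a ∷ y) + cost (a ∷ y)) ∎
    where open ≤-Reasoning

  cost-short : ∀ y → length y ≤ D → cost y ≤ (bracket + m) * D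
  cost-short y le = ≤-trans (≤-reflexive (sym (*-distribʳ-+ (length y) bracket m))) (*-monoʳ-≤ (bracket + m) le)

  private
    both-maximal : ∀ {α β p} → α ≤ p → β ≤ p → p + p ≤ α + β → α ≡ p × β ≡ p
    both-maximal {α} {β} {p} α≤p β≤p le =
      ≤-antisym α≤p (+-cancelʳ-≤ p p α (≤-trans le (+-monoʳ-≤ α β≤p))) ,
      ≤-antisym β≤p (+-cancelˡ-≤ p p β (≤-trans le (+-monoˡ-≤ β α≤p)))

  maximal-padding : ∀ {p α β} y ỹ → 0 < p → p ≤ m → α ≤ p → β ≤ p → length y ≤ D → Below μ y ỹ →
    ν (encode p ỹ p) ≤ ν (encode α y β) → α ≡ p × β ≡ p
  maximal-padding {p} {α} {β} y [] 0<p p≤m α≤p β≤p short (inj₁ lt) le =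
    ⊥-elim (n≮0 (≤-trans lt (≤-reflexive (additive-[] μ μ-++))))
  maximal-padding {p} {α} {β} y (a ∷ ỹ) 0<p p≤m α≤p β≤p short (inj₁ lt) le = ⊥-elim (<⇒≱ (begin-strict
      ν (encode α y β)               ≤⟨ ν-encode-upper α y (≤-trans β≤p p≤m) ⟩
      α + β + (K * μ y + cost y)     <⟨ +-mono-≤-< (+-mono-≤ α≤p β≤p) (+-monoʳ-< (K * μ y) (≤-<-trans (cost-short y short) K-large)) ⟩
      p + p + (K * μ y + K)          ≡⟨ cong (p + p +_) (trans (+-comm (K * μ y) K) (sym (*-suc K (μ y)))) ⟩
      p + p + K * suc (μ y)          ≤⟨ +-monoʳ-≤ (p + p) (*-monoʳ-≤ K lt) ⟩
      p + p + K * μ (a ∷ ỹ)          ≤⟨ +-monoʳ-≤ (p + p) (m≤m+n _ _) ⟩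
      p + p + (K * μ (a ∷ ỹ) + _)    ≡⟨ ν-encode-∷ p a ỹ p≤m ⟨
      ν (encode p (a ∷ ỹ) p)         ∎) le)
    where open ≤-Reasoning
  maximal-padding {p} {α} {β} [] [] 0<p p≤m α≤p β≤p short (inj₂ _) le =
    ≤-antisym α≤p (≤-trans p≤ (m⊓n≤m α β)) , ≤-antisym β≤p (≤-trans p≤ (m⊓n≤n α β))
    where
    p≤ : p ≤ α ⊓ β
    p≤ = subst₂ _≤_ (trans (ν-pad (p ⊓ p)) (⊓-idem p)) (ν-pad (α ⊓ β)) le
  maximal-padding {p} {α} {β} [] (a ∷ ỹ) 0<p p≤m α≤p β≤p short (inj₂ _) le = ⊥-elim (<⇒≱ (begin-strict
      ν (pad (α ⊓ β))             ≡⟨ ν-pad (α ⊓ β) ⟩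
      α ⊓ β                       ≤⟨ ≤-trans (m⊓n≤m α β) α≤p ⟩
      p                           <⟨ m<m+n p 0<p ⟩
      p + p                       ≤⟨ m≤m+n (p + p) _ ⟩
      p + p + _                   ≡⟨ ν-encode-∷ p a ỹ p≤m ⟨
      ν (encode p (a ∷ ỹ) p)      ∎) le)
    where open ≤-Reasoning
  maximal-padding {p} {α} {β} (b ∷ y) (a ∷ ỹ) 0<p p≤m α≤p β≤p short (inj₂ (μ≤ , s≤s l≤)) le =
    both-maximal α≤p β≤p (+-cancelʳ-≤ _ (p + p) (α + β)
      (≤-trans (+-monoʳ-≤ (p + p) (+-mono-≤ (*-monoʳ-≤ K μ≤)
          (+-mono-≤ (*-monoʳ-≤ bracket (s≤s l≤)) (*-monoʳ-≤ m l≤))))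
        (subst₂ _≤_ (ν-encode-∷ p a ỹ p≤m) (ν-encode-∷ α b y (≤-trans β≤p p≤m)) le)))

  record Item : Set where
    constructor item
    field
      label  : Lab
      target : Str

  open Item public

  source : Item → Str
  source i = word (label i)

  record Compatible (i j : Item) : Set where
    field
      ⋢-source : ¬ (source i ⊑ source j)
      ⋢-target : ¬ (target i ⊑ target j)
      overlap≡ : overlapOf (target i) (target j) ≡
                 encode (lead (label j)) (overlapOf (source i) (source j)) (end (label i))
      short    : length (overlapOf (source i) (source j)) ≤ D

  open Compatible

  Compatible² : Item → Item → Set
  Compatible² i j = Compatible i j × Compatible j i

  Compatible²-sym : ∀ {i j} → Compatible² i j → Compatible² j i
  Compatible²-sym (c , d) = d , c

  mergeItems : Item → Item → Item
  mergeItems i j = item (lab (merge (source i) (source j)) (lead (label i)) (end (label j)))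
                        (merge (target i) (target j))

  compatible-merge : ∀ {i j q} → Compatible² i q → Compatible² j q →
    length (overlapOf (source i) (source q)) ≤ length (overlapOf (source i) (source j)) →
    length (overlapOf (target i) (target q)) ≤ length (overlapOf (target i) (target j)) →
    Compatible² (mergeItems i j) q
  compatible-merge {i} {j} {q} (iq , qi) (jq , qj) le le′ = record
    { ⋢-source = λ h → ⋢-source iq (⊑-trans (s⊑merge _ _) h)
    ; ⋢-target = λ h → ⋢-target iq (⊑-trans (s⊑merge _ _) h)
    ; overlap≡ = trans (overlapOf-mergeˡ (target i) (target j) (⋢-target jq))
        (trans (overlap≡ jq) (cong (λ y → encode (lead (label q)) y (end (label j)))
          (sym (overlapOf-mergeˡ (source i) (source j) (⋢-source jq)))))
    ; short = subst (λ y → length y ≤ D)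
        (sym (overlapOf-mergeˡ (source i) (source j) (⋢-source jq))) (short jq)
    } , record
    { ⋢-source = ⋢-merge (⋢-source qi) (⋢-source qj) le
    ; ⋢-target = ⋢-merge (⋢-target qi) (⋢-target qj) le′
    ; overlap≡ = trans (overlapOf-mergeʳ (target i) (target j) (⋢-target iq))
        (trans (overlap≡ qi) (cong (λ y → encode (lead (label i)) y (end (label q)))
          (sym (overlapOf-mergeʳ (source i) (source j) (⋢-source iq)))))
    ; short = subst (λ y → length y ≤ D)
        (sym (overlapOf-mergeʳ (source i) (source j) (⋢-source iq))) (short qi)
    }

  Fits : ℕ → Item → Set
  Fits err i = K * μ (source i) ≤ ν (target i) + err

  Δ : ℕ
  Δ = m + m + (bracket + m) * D

  fits-merge : ∀ {err i j} → lead (label j) ≤ m → end (label i) ≤ m → Compatible i j →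
               Fits err i → Fits err j → Fits (err + err + Δ) (mergeItems i j)
  fits-merge {err} {i} {j} α≤m β≤m c fi fj = +-cancelʳ-≤ (K * μ y) _ _ (begin
    K * μ (merge s t) + K * μ y                ≡⟨ *-distribˡ-+ K _ _ ⟨
    K * (μ (merge s t) + μ y)                  ≡⟨ cong (K *_) (additive-merge μ μ-++ s t) ⟩
    K * (μ s + μ t)                            ≡⟨ *-distribˡ-+ K (μ s) (μ t) ⟩
    K * μ s + K * μ t                          ≤⟨ +-mono-≤ fi fj ⟩
    ν s′ + err + (ν t′ + err)                  ≡⟨ solve 3 (λ a b e → a :+ e :+ (b :+ e) := a :+ b :+ (e :+ e)) refl (ν s′) (ν t′) err ⟩
    ν s′ + ν t′ + (err + err)                  ≡⟨ cong (_+ (err + err)) (additive-merge ν ν-++ s′ t′) ⟨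
    ν (merge s′ t′) + ν y′ + (err + err)       ≤⟨ +-monoˡ-≤ (err + err) (+-monoʳ-≤ (ν (merge s′ t′)) ν-y′) ⟩
    ν (merge s′ t′) + (K * μ y + Δ) + (err + err)
      ≡⟨ solve 4 (λ a b d e → a :+ (b :+ d) :+ (e :+ e) := a :+ (e :+ e :+ d) :+ b) refl (ν (merge s′ t′)) (K * μ y) Δ err ⟩
    ν (merge s′ t′) + (err + err + Δ) + K * μ y ∎)
    where
    open ≤-Reasoning
    open +-*-Solver using (solve; _:+_; _:=_)
    s t s′ t′ y y′ : Str
    s = source i
    t = source j
    s′ = target i
    t′ = target j
    y = overlapOf s t
    y′ = overlapOf s′ t′

    ν-y′ : ν y′ ≤ K * μ y + Δ
    ν-y′ = begin
      ν y′                                                 ≡⟨ cong ν (overlap≡ c) ⟩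
      ν (encode (lead (label j)) y (end (label i)))        ≤⟨ ν-encode-upper _ y β≤m ⟩
      lead (label j) + end (label i) + (K * μ y + cost y)  ≤⟨ +-mono-≤ (+-mono-≤ α≤m β≤m) (+-monoʳ-≤ (K * μ y) (cost-short y (short c))) ⟩
      m + m + (K * μ y + (bracket + m) * D)
        ≡⟨ solve 3 (λ m k d → m :+ m :+ (k :+ d) := k :+ (m :+ m :+ d)) refl m (K * μ y) ((bracket + m) * D) ⟩
      K * μ y + Δ ∎

  module _ {T i j J} (T<m : suc T ≤ m)
    (end-i : end (label i) ≡ suc T) (lead-j : lead (label j) ≡ suc T)
    (lead-i≤ : lead (label i) ≤ T) (end-j≤ : end (label j) ≤ T)
    (J≤ : All (λ k → lead (label k) ≤ T × end (label k) ≤ T) J)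
    (compatible : AllPairs Compatible² (i ∷ j ∷ J))
    (best : LexLongest μ (map source (i ∷ j ∷ J)) (source i) (source j))
    where

    private
      ij : Compatible i j
      ij = proj₁ (All.head (AllPairs.head compatible))

      lead≤ : All (λ k → lead (label k) ≤ suc T) (i ∷ j ∷ J)
      lead≤ = m≤n⇒m≤1+n lead-i≤ ∷ ≤-reflexive lead-j ∷ All.map (λ b → m≤n⇒m≤1+n (proj₁ b)) J≤

      end≤ : All (λ k → end (label k) ≤ suc T) (i ∷ j ∷ J)
      end≤ = ≤-reflexive end-i ∷ m≤n⇒m≤1+n end-j≤ ∷ All.map (λ b → m≤n⇒m≤1+n (proj₂ b)) J≤

      lead≡⇒j : ∀ {q} → q ∈ i ∷ j ∷ J → lead (label q) ≡ suc T → q ≡ j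
      lead≡⇒j (here refl)         eq = ⊥-elim (1+n≰n (subst (_≤ T) eq lead-i≤))
      lead≡⇒j (there (here refl)) eq = refl
      lead≡⇒j (there (there q∈))  eq = ⊥-elim (1+n≰n (subst (_≤ T) eq (proj₁ (All.lookup J≤ q∈))))

      end≡⇒i : ∀ {p} → p ∈ i ∷ j ∷ J → end (label p) ≡ suc T → p ≡ i
      end≡⇒i (here refl)         eq = refl
      end≡⇒i (there (here refl)) eq = ⊥-elim (1+n≰n (subst (_≤ T) eq end-j≤))
      end≡⇒i (there (there p∈))  eq = ⊥-elim (1+n≰n (subst (_≤ T) eq (proj₂ (All.lookup J≤ p∈))))

    forced : ∀ {p q Q} → i ∷ j ∷ J ↭ p ∷ q ∷ Q →
      ν (overlapOf (target i) (target j)) ≤ ν (overlapOf (target p) (target q)) → p ≡ i × q ≡ j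
    forced {p} {q} {Q} ρ le
      with p∈ ← ∈-resp-↭ (↭-sym ρ) (here refl) | q∈ ← ∈-resp-↭ (↭-sym ρ) (there (here refl))
      with ((pq , _) ∷ _) ∷ _ ← AllPairs-resp-↭ Compatible²-sym ρ compatible
      with α≡ , β≡ ← maximal-padding (overlapOf (source p) (source q)) (overlapOf (source i) (source j))
             (s≤s z≤n) T<m (All.lookup lead≤ q∈) (All.lookup end≤ p∈) (short pq)
             (best (source p) (source q) (map source Q , ↭-map⁺ source ρ))
             (subst₂ _≤_
               (cong ν (trans (overlap≡ ij) (cong₂ (λ a b → encode a (overlapOf (source i) (source j)) b) lead-j end-i)))
               (cong ν (overlap≡ pq)) le)
      = end≡⇒i p∈ β≡ , lead≡⇒j q∈ α≡

    compatible-step : AllPairs Compatible² (mergeItems i j ∷ J)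
    compatible-step = All.tabulate merged ∷ AllPairs.tail (AllPairs.tail compatible)
      where
      merged : ∀ {q} → q ∈ J → Compatible² (mergeItems i j) q
      merged {q} q∈ with J′ , J↭ ← ∈⇒↭ q∈ = compatible-merge
        (All.lookup (All.tail (AllPairs.head compatible)) q∈)
        (All.lookup (AllPairs.head (AllPairs.tail compatible)) q∈)
        (below⇒shorter μ μ-++ (source i) (source q) (source j)
          (best (source i) (source q) (map source (j ∷ J′) , ↭-map⁺ source ρ)))
        (below⇒shorter ν ν-++ (target i) (target q) (target j) (inj₁ (≰⇒> not-forced)))
        where
        ρ : i ∷ j ∷ J ↭ i ∷ q ∷ j ∷ J′
        ρ = prep i (↭-trans (prep j J↭) (swap j q ↭-refl))

        not-forced : ¬ (ν (overlapOf (target i) (target j)) ≤ ν (overlapOf (target i) (target q)))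
        not-forced le with refl ← proj₂ (forced ρ le) = 1+n≰n (subst (_≤ T) lead-j (proj₁ (All.lookup J≤ q∈)))

    forced-run : ∀ {R w} → R ↭ map target (i ∷ j ∷ J) → Run (LongestBy ν) R w →
      ∃[ R′ ] R′ ↭ map target (mergeItems i j ∷ J) × Run (LongestBy ν) R′ w
    forced-run ρ stop with () ← ↭-length ρ
    forced-run ρ (step R↭ best′ rest)
      with _ ∷ _ ∷ _ , refl , σ ← ↭-map-inv target (↭-trans (↭-sym ρ) R↭)
      with refl , refl ← forced σ (best′ _ _ (map target J , ρ))
      = _ , prep _ (↭-map⁺ target (↭-sym (drop-∷ (drop-∷ σ)))) , rest

  simulate : ∀ {T L I w} → Guided μ T L w → L ≡ map label I → ∀ err → T ≤ m →
             AllPairs Compatible² I → All (Fits err) I →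
             ∀ {R w′} → R ↭ map target I → Run (LongestBy ν) R w′ →
             K * μ w ≤ ν w′ + slack Δ T err
  simulate {I = item _ _ ∷ []} stop refl err T≤m cs (f ∷ []) ρ stop
    with refl ← ↭-singleton-inv ρ = f
  simulate {I = item _ _ ∷ []} stop refl err T≤m cs fs ρ (step R↭ _ _)
    with () ← ↭-length (↭-trans (↭-sym ρ) R↭)
  simulate {I = I} (step {s = s} {t} L↭ best g) refl err T≤m cs fs ρ run
    with item _ _ ∷ item _ _ ∷ J , refl , σ ← ↭-map-inv label L↭
    with (α≤ , β≤) ∷ b ← guided-bounds g
    with J≤ ← All-map⁻ b
    with cs′ ← AllPairs-resp-↭ Compatible²-sym σ cs
    with f ∷ f′ ∷ fs′ ← All-resp-↭ σ fs
    with (c ∷ _) ∷ _ ← cs′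
    with α≤m ← ≤-trans (n≤1+n _) T≤m
    with best′ ← LexLongest-resp-↭ μ s t (↭-map⁺ source σ)
                   (subst (λ R → LexLongest μ R s t) (sym (map-∘ I)) best)
    with R′ , ρ′ , rest ← forced-run T≤m refl refl α≤ β≤ J≤ cs′ best′ (↭-trans ρ (↭-map⁺ target σ)) run
    = simulate g refl (err + err + Δ) α≤m
        (compatible-step T≤m refl refl α≤ β≤ J≤ cs′ best′)
        (fits-merge T≤m T≤m (proj₁ c) f f′ ∷ All.map (λ {k} h → weaken k h) fs′) ρ′ rest
    where
    weaken : ∀ k → Fits err k → Fits (err + err + Δ) k
    weaken k h = ≤-trans h (+-monoʳ-≤ (ν (target k)) (≤-trans (m≤m+n err err) (m≤m+n (err + err) Δ)))

Incomparable : Str → Str → Set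
Incomparable s t = ¬ (s ⊑ t) × ¬ (t ⊑ s)

Incomparable-sym : ∀ {s t} → Incomparable s t → Incomparable t s
Incomparable-sym (n , n′) = n′ , n

AllPairs-zipAll : ∀ {A : Set} {P : A → Set} {R : A → A → Set} {xs} → All P xs → AllPairs R xs →
                  AllPairs (λ x y → P x × P y × R x y) xs
AllPairs-zipAll []       []       = []
AllPairs-zipAll (p ∷ ps) (r ∷ rs) = All.zipWith (λ (q , t) → p , q , t) (ps , r) ∷ AllPairs-zipAll ps rs

AllPairs-lookup : ∀ {A : Set} {R : A → A → Set} → (∀ {x y} → R x y → R y x) →
                  ∀ {xs x y} → AllPairs R xs → x ∈ xs → y ∈ xs → x ≢ y → R x y
AllPairs-lookup sym-R (r ∷ rs) (here refl) (here refl) x≢y = ⊥-elim (x≢y refl)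
AllPairs-lookup sym-R (r ∷ rs) (here refl) (there y∈)  x≢y = All.lookup r y∈
AllPairs-lookup sym-R (r ∷ rs) (there x∈)  (here refl) x≢y = sym-R (All.lookup r x∈)
AllPairs-lookup sym-R (r ∷ rs) (there x∈)  (there y∈)  x≢y = AllPairs-lookup sym-R rs x∈ y∈ x≢y

dataset⇒incomparable : ∀ {S} → Dataset S → AllPairs Incomparable S
dataset⇒incomparable d = AllPairs.map
  (λ (s∈ , t∈ , s≢t) → substringFree s∈ t∈ s≢t , substringFree t∈ s∈ (λ eq → s≢t (sym eq)))
  (AllPairs-zipAll (All.tabulate id) unique)
  where open Dataset d

incomparable⇒dataset : ∀ {S} → S ≢ [] → AllPairs Incomparable S → Dataset S
incomparable⇒dataset S≢[] rs = record
  { nonEmpty      = S≢[]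
  ; unique        = AllPairs.map (λ { (s⋢s , _) refl → s⋢s ⊑-refl }) rs
  ; substringFree = λ s∈ t∈ s≢t → proj₁ (AllPairs-lookup Incomparable-sym rs s∈ t∈ s≢t)
  }

length≤sum : ∀ (S : List Str) → All (λ s → length s ≤ sum (map length S)) S
length≤sum []      = []
length≤sum (s ∷ S) = m≤m+n _ _ ∷ All.map (λ le → ≤-trans le (m≤n+m _ (length s))) (length≤sum S)

map≡[] : ∀ {A B : Set} (f : A → B) xs → map f xs ≡ [] → xs ≡ []
map≡[] f [] _ = refl

module Reduction
  (μ ν : Str → ℕ) (μ-++ : Additive μ) (ν-++ : Additive ν)
  (bracket : ℕ) (ν-pad₁ : ν (0 ∷ []) ≡ 1) (ν-bracket : ∀ a → ν (2 + a ∷ []) + ν (1 ∷ []) ≡ bracket)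
  where

  Reduced : Str → Str → ℕ → ℕ → ℕ → Set
  Reduced w v err C K = ∃[ S′ ] Dataset S′ ×
    (∀ {w′} → Run (LongestBy ν) S′ w′ → K * μ w ≤ ν w′ + err) ×
    (∃[ v′ ] Superstring S′ v′ × ν v′ ≤ K * μ v + C)

  reduce : ∀ {S w v} → Dataset S → Run (LexLongest μ) S w → Superstring S v →
    ∃[ err ] ∃[ C ] ∃[ K₀ ] (∀ K → K₀ ≤ K → Reduced w v err C K)
  reduce {S} {w} {v} d run sup with guide run
  ... | m , L , L↭ , g = slack (m + m + (bracket + m) * D) m 0 , C , suc ((bracket + m) * D) , reduced
    where
    D C : ℕ
    D = sum (map length S)
    C = m + m + (bracket * length v + m * length v)

    onLabels : ∀ {P : Str → Set} → All P S → All (λ l → P (word l)) L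
    onLabels ps = All-map⁻ (All-resp-↭ (↭-sym L↭) ps)

    reduced : ∀ K → suc ((bracket + m) * D) ≤ K → Reduced w v (slack (m + m + (bracket + m) * D) m 0) C K
    reduced K K-large = map target I , incomparable⇒dataset nonEmpty′
        (AllPairs.map⁺ (AllPairs.map (λ (c , c′) → Compatible.⋢-target c , Compatible.⋢-target c′) compatible)) ,
      simulate g (sym (trans (sym (map-∘ L)) (map-id L))) 0 ≤-refl compatible fits ↭-refl ,
      encode m v m , superstring ,
      ≤-trans (ν-encode-upper m v ≤-refl) (≤-reflexive (trans (+-comm (m + m) _)
        (trans (+-assoc (K * μ v) _ (m + m)) (cong (K * μ v +_) (+-comm _ (m + m))))))
      where
      open Simulation μ ν μ-++ ν-++ bracket ν-pad₁ ν-bracket K m D K-large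

      toItem : Lab → Item
      toItem l = item l (encode (lead l) (word l) (end l))

      I : List Item
      I = map toItem L

      compatible₁ : ∀ {k l} → lead l ≤ m → end k ≤ m → length (word k) ≤ D →
                    Incomparable (word k) (word l) → Compatible (toItem k) (toItem l)
      compatible₁ {k} {l} α≤m β≤m len (n , n′) = record
        { ⋢-source = n
        ; ⋢-target = λ h → n (encode-cancel-⊑ (word k) (word l) h)
        ; overlap≡ = overlapOf-encode α≤m n n′
        ; short    = ≤-trans (suffix-length (front (findOverlap (word k) (word l)))
                       (left (findOverlap (word k) (word l)))) len
        }

      compatible : AllPairs Compatible² I
      compatible = AllPairs.map⁺ (AllPairs.map
        (λ (((αk , βk) , k≤) , ((αl , βl) , l≤) , inc) →
           compatible₁ αl βk k≤ inc , compatible₁ αk βl l≤ (Incomparable-sym inc))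
        (AllPairs-zipAll (All.zip (guided-bounds g , onLabels (length≤sum S)))
          (AllPairs.map⁻ (AllPairs-resp-↭ Incomparable-sym (↭-sym L↭) (dataset⇒incomparable d)))))

      fits : All (Fits 0) I
      fits = All-map⁺ (All.map (λ {l} (_ , β≤) → ≤-trans (ν-encode-lower (lead l) (word l) β≤)
                                            (≤-reflexive (sym (+-identityʳ _)))) (guided-bounds g))

      superstring : Superstring (map target I) (encode m v m)
      superstring = All-map⁺ (All-map⁺ (All.zipWith (λ ((α≤ , β≤) , s⊑v) → encode-mono-⊑ α≤ β≤ s⊑v)
        (guided-bounds g , onLabels sup)))

      nonEmpty′ : map target I ≢ []
      nonEmpty′ eq = Dataset.nonEmpty d (↭-empty-inv (↭-sym (subst (λ L → map word L ↭ S)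
        (map≡[] toItem L (map≡[] target I eq)) L↭)))

-- Comparison of reals

ι : ℕ → ℚ
ι k = ℤ.+ k ℚ./ 1

ιᵘ : ℕ → ℚᵘ.ℚᵘ
ιᵘ k = mkℚᵘ (ℤ.+ k) 0

toℚᵘ-ι : ∀ k → toℚᵘ (ι k) ℚᵘ.≃ ιᵘ k
toℚᵘ-ι k = ℚ.toℚᵘ-fromℚᵘ (ιᵘ k)

ι-+ : ∀ j k → ι (j ℕ.+ k) ≡ ι j ℚ.+ ι k
ι-+ j k = ℚ.toℚᵘ-injective (begin-equality
  toℚᵘ (ι (j ℕ.+ k))             ≃⟨ toℚᵘ-ι (j ℕ.+ k) ⟩
  ιᵘ (j ℕ.+ k)                   ≃⟨ *≡* (cong (ℤ._* ℤ.+ 1) (cong₂ ℤ._+_ (sym (ℤ.*-identityʳ (ℤ.+ j))) (sym (ℤ.*-identityʳ (ℤ.+ k))))) ⟩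
  ιᵘ j ℚᵘ.+ ιᵘ k                 ≃⟨ ℚᵘ.+-cong (toℚᵘ-ι j) (toℚᵘ-ι k) ⟨
  toℚᵘ (ι j) ℚᵘ.+ toℚᵘ (ι k)     ≃⟨ ℚ.toℚᵘ-homo-+ (ι j) (ι k) ⟨
  toℚᵘ (ι j ℚ.+ ι k)             ∎)
  where open ℚᵘ.≤-Reasoning

ι-* : ∀ j k → ι (j ℕ.* k) ≡ ι j ℚ.* ι k
ι-* j k = ℚ.toℚᵘ-injective (begin-equality
  toℚᵘ (ι (j ℕ.* k))             ≃⟨ toℚᵘ-ι (j ℕ.* k) ⟩
  ιᵘ (j ℕ.* k)                   ≃⟨ *≡* (cong (ℤ._* ℤ.+ 1) (ℤ.pos-* j k)) ⟩
  ιᵘ j ℚᵘ.* ιᵘ k                 ≃⟨ ℚᵘ.*-cong (toℚᵘ-ι j) (toℚᵘ-ι k) ⟨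
  toℚᵘ (ι j) ℚᵘ.* toℚᵘ (ι k)     ≃⟨ ℚ.toℚᵘ-homo-* (ι j) (ι k) ⟨
  toℚᵘ (ι j ℚ.* ι k)             ∎)
  where open ℚᵘ.≤-Reasoning

ι-mono : ∀ j k → j ℕ.≤ k → ι j ℚ.≤ ι k
ι-mono j k j≤k = ℚ.toℚᵘ-cancel-≤ (begin
  toℚᵘ (ι j)   ≃⟨ toℚᵘ-ι j ⟩
  ιᵘ j         ≤⟨ *≤* (ℤ.*-monoʳ-≤-nonNeg (ℤ.+ 1) (ℤ.+≤+ j≤k)) ⟩
  ιᵘ k         ≃⟨ toℚᵘ-ι k ⟨
  toℚᵘ (ι k)   ∎)
  where open ℚᵘ.≤-Reasoning

ι-nonNeg : ∀ k → 0ℚ ℚ.≤ ι k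
ι-nonNeg k = ι-mono 0 k ℕ.z≤n

p≤ι∣↥p∣ : ∀ p → p ℚ.≤ ι ℤ.∣ ℚ.↥ p ∣
p≤ι∣↥p∣ p@(mkℚ n d _) = ℚ.toℚᵘ-cancel-≤ (begin
  mkℚᵘ n d               ≤⟨ *≤* (ineq n) ⟩
  ιᵘ ℤ.∣ n ∣             ≃⟨ toℚᵘ-ι ℤ.∣ n ∣ ⟨
  toℚᵘ (ι ℤ.∣ n ∣)       ∎)
  where
  open ℚᵘ.≤-Reasoning
  ineq : ∀ n → n ℤ.* ℤ.+ 1 ℤ.≤ ℤ.+ ℤ.∣ n ∣ ℤ.* ℤ.+ suc d
  ineq (ℤ.+ n)    = subst₂ ℤ._≤_ (ℤ.pos-* n 1) (ℤ.pos-* n (suc d)) (ℤ.+≤+ (ℕ.*-monoʳ-≤ n (ℕ.s≤s ℕ.z≤n)))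
  ineq ℤ.-[1+ n ] = ℤ.-≤+

archimedean : ∀ x ε → 0ℚ ℚ.< ε → ∃[ K ] x ℚ.≤ ι K ℚ.* ε
archimedean x ε 0<ε = ℤ.∣ ℚ.↥ r ∣ , (begin
  x                              ≡⟨ ℚ.*-identityʳ x ⟨
  x ℚ.* 1ℚ                       ≡⟨ cong (x ℚ.*_) (ℚ.*-inverseˡ ε) ⟨
  x ℚ.* (ℚ.1/ ε ℚ.* ε)           ≡⟨ ℚ.*-assoc x (ℚ.1/ ε) ε ⟨
  r ℚ.* ε                        ≤⟨ ℚ.*-monoʳ-≤-nonNeg ε {{ℚ.nonNegative (ℚ.<⇒≤ 0<ε)}} (p≤ι∣↥p∣ r) ⟩
  ι ℤ.∣ ℚ.↥ r ∣ ℚ.* ε            ∎)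
  where
  open ℚ.≤-Reasoning
  instance
    ε-nonZero : ℚ.NonZero ε
    ε-nonZero = ℚ.pos⇒nonZero ε {{ℚ.positive 0<ε}}
  r : ℚ
  r = x ℚ.* ℚ.1/ ε

≤+∣-∣ : ∀ p q {ε} → ℚ.∣ p ℚ.- q ∣ ℚ.≤ ε → p ℚ.≤ q ℚ.+ ε
≤+∣-∣ p q {ε} le = begin
  p                   ≡⟨ solve 2 (λ p q → p := q :+ (p :- q)) refl p q ⟩
  q ℚ.+ (p ℚ.- q)     ≤⟨ ℚ.+-monoʳ-≤ q (ℚ.≤-trans (p≤∣p∣ (p ℚ.- q)) le) ⟩
  q ℚ.+ ε             ∎
  where
  open ℚ.≤-Reasoning
  open ℚ-Solver.+-*-Solver
  p≤∣p∣ : ∀ r → r ℚ.≤ ℚ.∣ r ∣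
  p≤∣p∣ r with 0ℚ ℚ.≤? r
  ... | yes 0≤r = ℚ.≤-reflexive (sym (ℚ.0≤p⇒∣p∣≡p 0≤r))
  ... | no  0≰r = ℚ.≤-trans (ℚ.<⇒≤ (ℚ.≰⇒> 0≰r)) (ℚ.0≤∣p∣ r)

-- Beyond the Cauchy moduli the inequality at a single index is decidable and
-- follows from the inequality at any later index.
≤ᴿ-stable : ∀ x y → (∀ ε → 0ℚ ℚ.< ε →
              ¬ ¬ (∃[ N ] (∀ n → N ℕ.≤ n → seq x n ℚ.≤ seq y n ℚ.+ ε))) → x ≤ᴿ y
≤ᴿ-stable x y h ε 0<ε = N , bound
  where
  ⅓ δ : ℚ
  ⅓ = ℤ.+ 1 ℚ./ 3
  δ = ⅓ ℚ.* ε

  0<δ : 0ℚ ℚ.< δ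
  0<δ = ℚ.positive⁻¹ δ {{ℚ.pos*pos⇒pos ⅓ ε {{ℚ.positive 0<ε}}}}

  N₁ N₂ N : ℕ
  N₁ = proj₁ (cauchy x δ 0<δ)
  N₂ = proj₁ (cauchy y δ 0<δ)
  N = N₁ ℕ.⊔ N₂

  bound : ∀ n → N ℕ.≤ n → seq x n ℚ.≤ seq y n ℚ.+ ε
  bound n N≤n with seq x n ℚ.≤? seq y n ℚ.+ ε
  ... | yes le = le
  ... | no ≰ = ⊥-elim (h δ 0<δ λ (M , close) → ≰ (transfer M close))
    where
    open ℚ.≤-Reasoning
    open ℚ-Solver.+-*-Solver
    N₁≤n : N₁ ℕ.≤ n
    N₁≤n = ℕ.≤-trans (ℕ.m≤m⊔n N₁ N₂) N≤n
    N₂≤n : N₂ ℕ.≤ n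
    N₂≤n = ℕ.≤-trans (ℕ.m≤n⊔m N₁ N₂) N≤n

    transfer : ∀ M → (∀ n → M ℕ.≤ n → seq x n ℚ.≤ seq y n ℚ.+ δ) → seq x n ℚ.≤ seq y n ℚ.+ ε
    transfer M close = begin
      seq x n                        ≤⟨ ≤+∣-∣ _ _ (proj₂ (cauchy x δ 0<δ) n k N₁≤n (ℕ.≤-trans N₁≤n n≤k)) ⟩
      seq x k ℚ.+ δ                  ≤⟨ ℚ.+-monoˡ-≤ δ (close k (ℕ.m≤n⊔m n M)) ⟩
      seq y k ℚ.+ δ ℚ.+ δ            ≤⟨ ℚ.+-monoˡ-≤ δ (ℚ.+-monoˡ-≤ δ (≤+∣-∣ (seq y k) (seq y n)
                                          (proj₂ (cauchy y δ 0<δ) k n (ℕ.≤-trans N₂≤n n≤k) N₂≤n))) ⟩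
      seq y n ℚ.+ δ ℚ.+ δ ℚ.+ δ      ≡⟨ solve 2 (λ y e → y :+ con ⅓ :* e :+ con ⅓ :* e :+ con ⅓ :* e := y :+ e) refl (seq y n) ε ⟩
      seq y n ℚ.+ ε                  ∎
      where
      k : ℕ
      k = n ℕ.⊔ M
      n≤k : n ℕ.≤ k
      n≤k = ℕ.m≤m⊔n n M

0<1 : 0ℚ ℚ.< 1ℚ
0<1 = ℚ.positive⁻¹ 1ℚ

1≤p+1⇒0≤p : ∀ p → 1ℚ ℚ.≤ p ℚ.* 1ℚ ℚ.+ 1ℚ → 0ℚ ℚ.≤ p
1≤p+1⇒0≤p p le = begin
  0ℚ                           ≡⟨ ℚ.+-inverseʳ 1ℚ ⟨
  1ℚ ℚ.- 1ℚ                    ≤⟨ ℚ.+-monoˡ-≤ (ℚ.- 1ℚ) le ⟩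
  p ℚ.* 1ℚ ℚ.+ 1ℚ ℚ.- 1ℚ       ≡⟨ solve 2 (λ p o → p :+ o :- o := p) refl (p ℚ.* 1ℚ) 1ℚ ⟩
  p ℚ.* 1ℚ                     ≡⟨ ℚ.*-identityʳ p ⟩
  p                            ∎
  where
  open ℚ.≤-Reasoning
  open ℚ-Solver.+-*-Solver

rescale : ∀ {k a b d e p q c B ε} → 0ℚ ℚ.< k → 0ℚ ℚ.≤ c → 0ℚ ℚ.≤ d → c ℚ.≤ B →
          k ℚ.* a ℚ.≤ p ℚ.+ e → p ℚ.≤ c ℚ.* q ℚ.+ 1ℚ → q ℚ.≤ k ℚ.* b ℚ.+ d →
          B ℚ.* d ℚ.+ 1ℚ ℚ.+ e ℚ.≤ k ℚ.* ε → a ℚ.≤ c ℚ.* b ℚ.+ ε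
rescale {k} {a} {b} {d} {e} {p} {q} {c} {B} {ε} 0<k 0≤c 0≤d c≤B ka≤ p≤ q≤ large =
  ℚ.*-cancelˡ-≤-pos k {{ℚ.positive 0<k}} (begin
    k ℚ.* a                                        ≤⟨ ka≤ ⟩
    p ℚ.+ e                                        ≤⟨ ℚ.+-monoˡ-≤ e p≤ ⟩
    c ℚ.* q ℚ.+ 1ℚ ℚ.+ e                           ≤⟨ ℚ.+-monoˡ-≤ e (ℚ.+-monoˡ-≤ 1ℚ
                                                        (ℚ.*-monoˡ-≤-nonNeg c {{ℚ.nonNegative 0≤c}} q≤)) ⟩
    c ℚ.* (k ℚ.* b ℚ.+ d) ℚ.+ 1ℚ ℚ.+ e
      ≡⟨ solve 6 (λ c k b d o e → c :* (k :* b :+ d) :+ o :+ e := k :* (c :* b) :+ (c :* d :+ o :+ e)) refl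
           c k b d 1ℚ e ⟩
    k ℚ.* (c ℚ.* b) ℚ.+ (c ℚ.* d ℚ.+ 1ℚ ℚ.+ e)     ≤⟨ ℚ.+-monoʳ-≤ (k ℚ.* (c ℚ.* b)) (ℚ.+-monoˡ-≤ e (ℚ.+-monoˡ-≤ 1ℚ
                                                        (ℚ.*-monoʳ-≤-nonNeg d {{ℚ.nonNegative 0≤d}} c≤B))) ⟩
    k ℚ.* (c ℚ.* b) ℚ.+ (B ℚ.* d ℚ.+ 1ℚ ℚ.+ e)     ≤⟨ ℚ.+-monoʳ-≤ (k ℚ.* (c ℚ.* b)) large ⟩
    k ℚ.* (c ℚ.* b) ℚ.+ k ℚ.* ε                    ≡⟨ ℚ.*-distribˡ-+ k (c ℚ.* b) ε ⟨
    k ℚ.* (c ℚ.* b ℚ.+ ε)                          ∎)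
  where
  open ℚ.≤-Reasoning
  open ℚ-Solver.+-*-Solver

≤ᴿ-limit : ∀ c a b err C K₀ → fromℕ 1 ≤ᴿ c *ᴿ fromℕ 1 →
  (∀ K → K₀ ℕ.≤ K → ¬ ¬ (∃[ P ] ∃[ Q ] K ℕ.* a ℕ.≤ P ℕ.+ err × Q ℕ.≤ K ℕ.* b ℕ.+ C ×
                                        fromℕ P ≤ᴿ c *ᴿ fromℕ Q)) →
  fromℕ a ≤ᴿ c *ᴿ fromℕ b
≤ᴿ-limit c a b err C K₀ 1≤c h = ≤ᴿ-stable (fromℕ a) (c *ᴿ fromℕ b) bound
  where
  N₁ N₂ : ℕ
  N₁ = proj₁ (cauchy c 1ℚ 0<1)
  N₂ = proj₁ (1≤c 1ℚ 0<1)

  B : ℚ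
  B = seq c N₁ ℚ.+ 1ℚ

  final : ∀ ε K → 1 ℕ.≤ K → B ℚ.* ι C ℚ.+ 1ℚ ℚ.+ ι err ℚ.≤ ι K ℚ.* ε →
    ∀ P Q → K ℕ.* a ℕ.≤ P ℕ.+ err → Q ℕ.≤ K ℕ.* b ℕ.+ C → (P≤cQ : fromℕ P ≤ᴿ c *ᴿ fromℕ Q) →
    ∀ n → N₁ ℕ.⊔ N₂ ℕ.⊔ proj₁ (P≤cQ 1ℚ 0<1) ℕ.≤ n → ι a ℚ.≤ seq c n ℚ.* ι b ℚ.+ ε
  final ε K 1≤K large P Q Ka≤ Q≤ P≤cQ n N≤n = rescale {ι K} {ι a} {ι b} {ι C} {ι err} {ι P} {ι Q} {seq c n} {B} {ε}
    (ℚ.<-≤-trans 0<1 (ι-mono 1 K 1≤K))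
    (1≤p+1⇒0≤p (seq c n) (proj₂ (1≤c 1ℚ 0<1) n (ℕ.≤-trans (ℕ.m≤n⊔m N₁ N₂) N₁⊔N₂≤n)))
    (ι-nonNeg C)
    (≤+∣-∣ (seq c n) (seq c N₁) (proj₂ (cauchy c 1ℚ 0<1) n N₁ (ℕ.≤-trans (ℕ.m≤m⊔n N₁ N₂) N₁⊔N₂≤n) ℕ.≤-refl))
    (subst₂ ℚ._≤_ (ι-* K a) (ι-+ P err) (ι-mono (K ℕ.* a) (P ℕ.+ err) Ka≤))
    (proj₂ (P≤cQ 1ℚ 0<1) n (ℕ.≤-trans (ℕ.m≤n⊔m (N₁ ℕ.⊔ N₂) _) N≤n))
    (subst (ι Q ℚ.≤_) (trans (ι-+ (K ℕ.* b) C) (cong (ℚ._+ ι C) (ι-* K b))) (ι-mono Q (K ℕ.* b ℕ.+ C) Q≤))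
    large
    where
    N₁⊔N₂≤n : N₁ ℕ.⊔ N₂ ℕ.≤ n
    N₁⊔N₂≤n = ℕ.≤-trans (ℕ.m≤m⊔n (N₁ ℕ.⊔ N₂) _) N≤n

  bound : ∀ ε → 0ℚ ℚ.< ε → ¬ ¬ (∃[ N ] (∀ n → N ℕ.≤ n → ι a ℚ.≤ seq c n ℚ.* ι b ℚ.+ ε))
  bound ε 0<ε ¬∃ = above (archimedean X ε 0<ε)
    where
    X : ℚ
    X = B ℚ.* ι C ℚ.+ 1ℚ ℚ.+ ι err

    above : ∃[ K ] X ℚ.≤ ι K ℚ.* ε → ⊥
    above (K₁ , le) = h K (ℕ.m≤n⇒m≤1+n (ℕ.m≤n+m K₀ K₁)) λ (P , Q , Ka≤ , Q≤ , P≤cQ) →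
      ¬∃ (N₁ ℕ.⊔ N₂ ℕ.⊔ proj₁ (P≤cQ 1ℚ 0<1) ,
          final ε K (ℕ.s≤s ℕ.z≤n)
            (ℚ.≤-trans le (ℚ.*-monoʳ-≤-nonNeg ε {{ℚ.nonNegative (ℚ.<⇒≤ 0<ε)}} {ι K₁} {ι K}
              (ι-mono K₁ K (ℕ.m≤n⇒m≤1+n (ℕ.m≤m+n K₁ K₀)))))
            P Q Ka≤ Q≤ P≤cQ)
      where
      K : ℕ
      K = suc (K₁ ℕ.+ K₀)

-- Existence of greedy runs

PairOf : List Str → Set
PairOf R = ∃[ s ] ∃[ t ] Pair R s t

picks : (R : List Str) → List (∃[ s ] ∃[ Q ] R ↭ s ∷ Q)
picks []      = []
picks (s ∷ R) = (s , R , ↭-refl) ∷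
  map (λ (t , Q , ρ) → t , s ∷ Q , ↭-trans (prep s ρ) (swap s t ↭-refl)) (picks R)

picks-complete : ∀ {R s} → s ∈ R → Any (λ p → s ≡ proj₁ p) (picks R)
picks-complete (here s≡)  = here s≡
picks-complete (there s∈) = there (Any.map⁺ (picks-complete s∈))

pairs : (R : List Str) → List (PairOf R)
pairs R = concatMap (λ (s , Q , ρ) →
  map (λ (t , Q′ , σ) → s , t , Q′ , ↭-trans ρ (prep s σ)) (picks Q)) (picks R)

pairs-complete : ∀ {R s t} → Pair R s t →
                 Any (λ p → s ≡ proj₁ p × t ≡ proj₁ (proj₂ p)) (pairs R)
pairs-complete (Q , ρ) = Any.concatMap⁺ _ (Any.map
  (λ { {s , Q′ , σ} refl → Any.map⁺ (Any.map (λ t≡ → refl , t≡)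
         (picks-complete (∈-resp-↭ (drop-∷ (↭-trans (↭-sym ρ) σ)) (here refl)))) })
  (picks-complete (∈-resp-↭ (↭-sym ρ) (here refl))))

longestPair : ∀ ν s t Q → ∃[ p ] ∃[ q ] Pair (s ∷ t ∷ Q) p q × LongestBy ν (s ∷ t ∷ Q) p q
longestPair ν s t Q = proj₁ best , proj₁ (proj₂ best) , proj₂ (proj₂ best) , longest′
  where
  R : List Str
  R = s ∷ t ∷ Q

  value : PairOf R → ℕ
  value (p , q , _) = ν (overlapOf p q)

  best : PairOf R
  best = argmax value (s , t , Q , ↭-refl) (pairs R)

  extract : ∀ {p q} {ps : List (PairOf R)} → All (λ x → value x ≤ value best) ps →
            Any (λ x → p ≡ proj₁ x × q ≡ proj₁ (proj₂ x)) ps → ν (overlapOf p q) ≤ value best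
  extract (le ∷ _) (here (refl , refl)) = le
  extract (_ ∷ le) (there a)            = extract le a

  longest′ : LongestBy ν R (proj₁ best) (proj₁ (proj₂ best))
  longest′ p q pq = extract (f[xs]≤f[argmax] (s , t , Q , ↭-refl) (pairs R)) (pairs-complete pq)

greedy : ∀ ν n R → length R ≡ suc n → ∃[ w ] Run (LongestBy ν) R w
greedy ν zero    (s ∷ [])    _  = s , stop
greedy ν (suc n) (s ∷ t ∷ Q) eq with longestPair ν s t Q
... | p , q , (Q′ , ρ) , best with greedy ν n (merge p q ∷ Q′) (suc-injective (trans (sym (↭-length ρ)) eq))
...   | w , run = w , step ρ best run

greedyOutput : (Str → ℕ) → List Str → Str
greedyOutput ν []      = []
greedyOutput ν (s ∷ R) = proj₁ (greedy ν (length R) (s ∷ R) refl)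

greedyRun : ∀ ν {R} → R ≢ [] → Run (LongestBy ν) R (greedyOutput ν R)
greedyRun ν {[]}    R≢[] = ⊥-elim (R≢[] refl)
greedyRun ν {s ∷ R} _    = proj₂ (greedy ν (length R) (s ∷ R) refl)

LongestBy-resp-↭ : ∀ ν {R R′} s t → R ↭ R′ → LongestBy ν R s t → LongestBy ν R′ s t
LongestBy-resp-↭ ν s t ρ best s′ t′ (Q , R′↭) = best s′ t′ (Q , ↭-trans ρ R′↭)

run-resp-↭ : ∀ ν {R R′ w} → R ↭ R′ → Run (LongestBy ν) R w → Run (LongestBy ν) R′ w
run-resp-↭ ν ρ stop with refl ← ↭-singleton-inv (↭-sym ρ) = stop
run-resp-↭ ν ρ (step {s = s} {t} R↭ best rest) =
  step (↭-trans (↭-sym ρ) R↭) (LongestBy-resp-↭ ν s t ρ best) rest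

Str-decTotalOrder : DecTotalOrder _ _ _
Str-decTotalOrder = Lex.≤-decTotalOrder ℕ.≤-decTotalOrder

open import Data.List.Sort Str-decTotalOrder using (sort; sort-↭; sort-↗)

sort-cong : ∀ {S T} → S ↭ T → sort S ≡ sort T
sort-cong {S} {T} ρ = Pointwise-≡⇒≡ (Pointwise.map Pointwise-≡⇒≡
  (↗↭↗⇒≋ O.totalOrder (sort-↗ S) (sort-↗ T)
    (↭⇒↭ₛ′ O.isEquivalence (↭-trans (sort-↭ S) (↭-trans ρ (↭-sym (sort-↭ T)))))))
  where module O = DecTotalOrder Str-decTotalOrder

-- Sorting first makes the output independent of how the dataset is listed.
greedyInstantiation : ∀ ν → Instantiation (LongestBy ν)
greedyInstantiation ν = record
  { output  = λ S → greedyOutput ν (sort S)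
  ; respect = λ _ ρ → cong (greedyOutput ν) (sort-cong ρ)
  ; run     = λ {S} d → run-resp-↭ ν (sort-↭ S) (greedyRun ν
      (λ eq → Dataset.nonEmpty d (↭-empty-inv (subst (S ↭_) eq (↭-sym (sort-↭ S))))))
  }

optimum-exists : ∀ ν {S v} → Superstring S v → ¬ ¬ (∃[ w ] Optimal ν S w)
optimum-exists ν {S} {v} sup ¬∃ = below (suc (ν v)) v sup ≤-refl
  where
  below : ∀ n v → Superstring S v → ν v < n → ⊥
  below (suc n) v sup (s≤s νv≤n) = ¬∃ (v , sup , minimal)
    where
    minimal : ∀ u → Superstring S u → ν v ≤ ν u
    minimal u sup′ with ν v ≤? ν u
    ... | yes le = le
    ... | no ≰   = ⊥-elim (below n u sup′ (<-≤-trans (≰⇒> ≰) νv≤n))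

singleton-run : ∀ {rule s w} → Run rule (s ∷ []) w → w ≡ s
singleton-run stop = refl
singleton-run (step R↭ _ _) with () ← ↭-length R↭

module Transfer
  (μ ν : Str → ℕ) (μ-++ : Additive μ) (ν-++ : Additive ν)
  (bracket : ℕ) (ν-pad₁ : ν (0 ∷ []) ≡ 1) (ν-bracket : ∀ a → ν (2 + a ∷ []) + ν (1 ∷ []) ≡ bracket)
  where

  open Reduction μ ν μ-++ ν-++ bracket ν-pad₁ ν-bracket

  1≤factor : ∀ c (B : Instantiation (LongestBy ν)) → ApproximateFor c ν B → fromℕ 1 ≤ᴿ c *ᴿ fromℕ 1
  1≤factor c B approx = subst₂ (λ m n → fromℕ m ≤ᴿ c *ᴿ fromℕ n)
    (trans (cong ν (singleton-run (run B d))) ν-pad₁) ν-pad₁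
    (approx S (0 ∷ []) d (⊑-refl ∷ [] , minimal))
    where
    S : List Str
    S = (0 ∷ []) ∷ []

    d : Dataset S
    d = incomparable⇒dataset (λ ()) ([] ∷ [])

    minimal : ∀ v → Superstring S v → ν (0 ∷ []) ≤ ν v
    minimal v (h ∷ []) with ⊑⇒++ h
    ... | x , z , eq = ≤-trans (≤-trans (m≤m+n _ (ν z)) (m≤n+m _ (ν x)))
      (≤-reflexive (sym (trans (cong ν eq) (trans (ν-++ x _) (cong (ν x +_) (ν-++ (0 ∷ []) z))))))

  transfer : ∀ c (B : Instantiation (LongestBy ν)) → ApproximateFor c ν B →
             ∀ {S w v} → Dataset S → Run (LexLongest μ) S w → Superstring S v →
             fromℕ (μ w) ≤ᴿ c *ᴿ fromℕ (μ v)
  transfer c B approx {w = w} {v} d source-run sup with reduce d source-run sup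
  ... | err , C , K₀ , reduced = ≤ᴿ-limit c (μ w) (μ v) err C K₀ (1≤factor c B approx) instances
    where
    instances : ∀ K → K₀ ≤ K → ¬ ¬ (∃[ P ] ∃[ Q ] K * μ w ≤ P + err × Q ≤ K * μ v + C ×
                                                  fromℕ P ≤ᴿ c *ᴿ fromℕ Q)
    instances K K₀≤K ¬∃ with reduced K K₀≤K
    ... | S′ , d′ , lower , v′ , sup′ , upper = optimum-exists ν sup′ λ (u , optimal) →
      ¬∃ (ν (output B S′) , ν u , lower (run B d′) ,
          ≤-trans (proj₂ optimal v′ sup′) upper , approx S′ u d′ optimal)

length#-++ : ∀ # → Additive (length# #)
length#-++ # x y = trans (cong length (filter-++ (ℕ._≟ #) x y)) (length-++ (filter (ℕ._≟ #) x))

run-map : ∀ {rule rule′ : Rule} → (∀ R s t → rule R s t → rule′ R s t) →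
          ∀ {R w} → Run rule R w → Run rule′ R w
run-map f stop                = stop
run-map f (step R↭ best rest) = step R↭ (f _ _ _ best) (run-map f rest)

longest⇒lexLongest : ∀ R s t → Longest R s t → LexLongest length R s t
longest⇒lexLongest R s t best s′ t′ p = inj₂ (best s′ t′ p , best s′ t′ p)

longest#⇒lexLongest : ∀ # {R s t} → Longest# # R s t → LongestAmongLongest# # R s t →
                      LexLongest (length# #) R s t
longest#⇒lexLongest # best among s′ t′ p with m≤n⇒m<n∨m≡n (best s′ t′ p)
... | inj₁ lt = inj₁ lt
... | inj₂ eq = inj₂ (≤-reflexive eq ,
  among s′ t′ p (λ s″ t″ p″ → ≤-trans (best s″ t″ p″) (≤-reflexive (sym eq))))

everyStep⇒run : ∀ # {R w} {r : Run (Longest# #) R w} → EveryStep (LongestAmongLongest# #) r →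
                Run (LexLongest (length# #)) R w
everyStep⇒run # stop = stop
everyStep⇒run # (step {s = s} {t} {R↭ = R↭} {best} among rest) =
  step R↭ (longest#⇒lexLongest # {s = s} {t} best among) (everyStep⇒run # rest)

module #⇒length = Transfer length (length# 0) (λ x y → length-++ x) (length#-++ 0) 0 refl (λ _ → refl)

module length⇒# (# : Symbol) = Transfer (length# #) length (length#-++ #) (λ x y → length-++ x) 2 refl (λ _ → refl)

theorem6 : (c : ℝ) →
    ((∃[ A ] Approximate# c A) → (B : GA) → Approximate c B)
    × (((B : GA) → Approximate c B) → (A : GA#) → MergesLongest A → Approximate# c A)
theorem6 c =
  (λ (A , approx) B S v d (sup , _) →
    #⇒length.transfer c (A 0) (approx 0) d (run-map longest⇒lexLongest (run B d)) sup) ,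
  (λ approx A merges # S v d (sup , _) →
    length⇒#.transfer # c (greedyInstantiation length) (approx (greedyInstantiation length)) d
      (everyStep⇒run # (merges # d)) sup)
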